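{- There exists $g>0$ such that every cubic graph $G$ with girth at least $g$ has a cut containing at least $0.8704\,m$ edges, where $m$ is the total number of edges of $G$.
   Context: Graphs are finite and simple. A graph is cubic if every vertex has degree three. The girth of a graph is the length of its shortest cycle. A cut of $G$ is the set of all edges having one end-vertex in $A$ and the other in $B$, for some partition of the vertex set of $G$ into two sets $A$ and $B$. -}

module Defs where

open import Level using (0ℓ)
open import Data.Fin using (Fin; _<_; _<?_)
open import Data.Fin.Subset using (Subset; _∈_; ∁)
open import Data.Fin.Subset.Properties using (_∈?_)
open import Data.List using (List; _∷_; _∷ʳ_; length; filter; allFin; cartesianProduct)
open import Data.List.Relation.Unary.Linked using (Linked)
open import Data.List.Relation.Unary.Unique.Propositional using (Unique)
open import Data.Nat using (ℕ; _≤_)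
open import Data.Product using (_×_; _,_)
open import Data.Sum using (_⊎_)
open import Relation.Binary.Core using (Rel)
open import Relation.Binary.Definitions using (Symmetric; Irreflexive) renaming (Decidable to Decidable₂)
open import Relation.Binary.PropositionalEquality using (_≡_)
open import Relation.Nullary using (¬_)
open import Relation.Nullary.Construct.Add.Supremum public using (_⁺; [_]; ⊤⁺)
open import Relation.Nullary.Decidable using (_×-dec_; _⊎-dec_)
open import Relation.Unary using (Pred; Decidable)
open import Relation.Binary.Construct.Add.Supremum.NonStrict _≤_ public using (_≤⁺_)

record Graph (n : ℕ) : Set₁ where
  field
    Adj    : Rel (Fin n) 0ℓ
    adj?   : Decidable₂ Adj
    sym    : Symmetric Adj
    irrefl : Irreflexive _≡_ Adj

module _ {n : ℕ} (G : Graph n) where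
  open Graph G

  neighbours : Fin n → List (Fin n)
  neighbours v = filter (adj? v) (allFin n)

  degree : Fin n → ℕ
  degree v = length (neighbours v)

  Cubic : Set
  Cubic = ∀ v → degree v ≡ 3

  -- The edge {u , v} is represented once, by the pair with u < v.
  IsEdge : Pred (Fin n × Fin n) 0ℓ
  IsEdge (u , v) = u < v × Adj u v

  isEdge? : Decidable IsEdge
  isEdge? (u , v) = (u <? v) ×-dec adj? u v

  edges : List (Fin n × Fin n)
  edges = filter isEdge? (cartesianProduct (allFin n) (allFin n))

  -- The vertices in cyclic order are start ∷ rest; the closed walk returns to start.
  record Cycle : Set where
    field
      start    : Fin n
      rest     : List (Fin n)
      distinct : Unique (start ∷ rest)
      walk     : Linked Adj (start ∷ rest ∷ʳ start)
      nonDegenerate : 3 ≤ length (start ∷ rest)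

  cycleLength : Cycle → ℕ
  cycleLength C = length (start ∷ rest)
    where open Cycle C

  -- ℕ ⁺ is ℕ with a top element ⊤⁺, the girth of a graph without cycles.
  data IsGirth : ℕ ⁺ → Set where
    shortest : (C : Cycle) → (∀ C′ → cycleLength C ≤ cycleLength C′) →
               IsGirth [ cycleLength C ]
    acyclic  : ¬ Cycle → IsGirth ⊤⁺

-- The vertex set is partitioned into A and its complement ∁ A.
Crosses : ∀ {n} → Subset n → Pred (Fin n × Fin n) 0ℓ
Crosses A (u , v) = (u ∈ A × v ∈ ∁ A) ⊎ (u ∈ ∁ A × v ∈ A)

crosses? : ∀ {n} (A : Subset n) → Decidable (Crosses A)
crosses? A (u , v) =
  ((u ∈? A) ×-dec (v ∈? ∁ A)) ⊎-dec ((u ∈? ∁ A) ×-dec (v ∈? A))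

cut : ∀ {n} → Graph n → Subset n → List (Fin n × Fin n)
cut G A = filter (crosses? A) (edges G)

{-# OPTIONS --safe #-}

-- Colour the vertices red and blue in synchronous rounds. A blank vertex looks
-- at its coloured neighbours and flips a fresh coin; it may take the colour
-- which is in the minority around it, and it stays blank if the coin says so. A
-- few random vertices are coloured in the first round, and ties are broken at
-- random in the last rounds.
--
-- Let the message from u to v at time t be the status of u in the process in
-- which v is kept blank. As long as v is blank, its neighbours have exactly the
-- statuses of their messages to v, and since the girth is large, these three
-- messages and the coins of v are independent. The messages themselves obey the
-- same rule with two neighbours. Since a vertex never changes its colour, the
-- history of a message is determined by the time and the colour of its only
-- change, so that the weights of all histories of the three neighbours of a
-- blank vertex can be summed up in a 3 × 3 × 3 tensor indexed by the present
-- statuses. Iterating this tensor, with every number rounded down, bounds the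
-- probability that an edge joins the two colours from below, and after 40 rounds
-- the bound exceeds 0.8704. So some outcome of the coins gives a cut as large.

module Submission where

open import Defs
open import Data.Bool using (Bool; true; false)
open import Data.Empty using (⊥)
open import Data.Fin using (Fin; zero; suc; toℕ; combine)
open import Data.Fin.Properties using (_≟_; combine-injectiveˡ; combine-injectiveʳ; combine-surjective; toℕ-fromℕ<)
open import Data.Fin.Subset using (Subset; inside; outside; ∁) renaming (_∈_ to _∈ₛ_)
open import Data.Fin.Subset.Properties using (x∉p⇒x∈∁p)
import Data.Integer as ℤ
import Data.Integer.Properties as ℤ
open import Data.List using (List; []; _∷_; _++_; _∷ʳ_; length; filter; concatMap; map; allFin; cartesianProduct)
open import Data.List.Membership.Propositional using (_∈_; _∉_; find; lose)
open import Data.List.Membership.Propositional.Properties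
  using (∈-∃++; ∈-filter⁺; ∈-filter⁻; ∈-allFin; ∈-concatMap⁺; ∈-concatMap⁻; ∈-++⁺ˡ; ∈-++⁺ʳ; ∈-++⁻)
import Data.List.Membership.DecPropositional as DecMembership
open import Data.List.Properties using (length-++; filter-all)
import Data.List.Relation.Unary.All as All
open All using (All; []; _∷_)
open import Data.List.Relation.Unary.All.Properties using (++⁻ˡ; ++⁻ʳ; ¬Any⇒All¬; all-filter)
open import Data.List.Relation.Unary.AllPairs using ([]; _∷_)
open import Data.List.Relation.Unary.Any using (here; there)
open import Data.List.Relation.Unary.Linked using (Linked; [-]; _∷_)
open import Data.List.Relation.Unary.Unique.Propositional using (Unique)
open import Data.List.Relation.Unary.Unique.Propositional.Properties using (allFin⁺; filter⁺)
open import Data.Nat hiding (_≟_)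
open import Data.Nat.DivMod using (_/_; _mod_; m%n<n; m<n⇒m%n≡m; m/n*n≤m)
open import Data.Nat.ListAction using (sum)
open import Data.Nat.Properties hiding (_≟_)
open import Data.Nat.Solver using (module +-*-Solver)
open import Data.Product using (Σ-syntax; ∃; ∃-syntax; _×_; _,_; proj₂)
import Data.Rational as ℚ
import Data.Rational.Properties as ℚ
import Data.Rational.Unnormalised as ℚᵘ
open ℚᵘ using (mkℚᵘ; *≤*)
import Data.Rational.Unnormalised.Properties as ℚᵘ
open import Data.Sum using (_⊎_; inj₁; inj₂; [_,_]′)
open import Data.Vec using (Vec; []; _∷_; lookup; _[_]≔_; tabulate)
open import Data.Vec.Properties using (lookup∘update′; lookup∘tabulate; lookup⇒[]=; []=⇒lookup)
open import Function using (_∘_)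
open import Level using (0ℓ)
open import Relation.Binary.Construct.Add.Supremum.NonStrict _≤_ using ([_]; _≤⊤⁺)
open import Relation.Binary.PropositionalEquality hiding ([_])
open import Relation.Nullary using (yes; no; ¬?; contradiction)
open import Relation.Unary using (Pred; Decidable)
open +-*-Solver


-- Expectations over independent coins

private variable
  A B : Set

∑ : List (ℕ × A) → (A → ℕ) → ℕ
∑ []            f = 0
∑ ((w , a) ∷ L) f = w * f a + ∑ L f

∑-mono : ∀ (L : List (ℕ × A)) {f g : A → ℕ} → (∀ a → f a ≤ g a) → ∑ L f ≤ ∑ L g
∑-mono []            f≤g = z≤n
∑-mono ((w , a) ∷ L) f≤g = +-mono-≤ (*-monoʳ-≤ w (f≤g a)) (∑-mono L f≤g)

∑-cong : ∀ (L : List (ℕ × A)) {f g : A → ℕ} → (∀ a → f a ≡ g a) → ∑ L f ≡ ∑ L g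
∑-cong []            f≡g = refl
∑-cong ((w , a) ∷ L) f≡g = cong₂ _+_ (cong (w *_) (f≡g a)) (∑-cong L f≡g)

∑-+ : ∀ (L : List (ℕ × A)) (f g : A → ℕ) → ∑ L (λ a → f a + g a) ≡ ∑ L f + ∑ L g
∑-+ []            f g = refl
∑-+ ((w , a) ∷ L) f g rewrite ∑-+ L f g =
  solve 5 (λ w x y u v → w :* (x :+ y) :+ (u :+ v) := (w :* x :+ u) :+ (w :* y :+ v))
    refl w (f a) (g a) (∑ L f) (∑ L g)

∑-* : ∀ (L : List (ℕ × A)) k (f : A → ℕ) → ∑ L (λ a → k * f a) ≡ k * ∑ L f
∑-* []            k f = sym (*-zeroʳ k)
∑-* ((w , a) ∷ L) k f rewrite ∑-* L k f =
  solve 4 (λ w k x u → w :* (k :* x) :+ k :* u := k :* (w :* x :+ u)) refl w k (f a) (∑ L f)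

total : List (ℕ × A) → ℕ
total L = ∑ L λ _ → 1

∑-const : ∀ (L : List (ℕ × A)) k → ∑ L (λ _ → k) ≡ k * total L
∑-const L k = trans (∑-cong L λ _ → sym (*-identityʳ k)) (∑-* L k λ _ → 1)

-- If all values were below `k`, each would be at least one less, and the weighted sum would fall
-- short of `k * total L` by at least `total L`, which is positive.
∑-attains : ∀ (L : List (ℕ × A)) → .{{NonZero (total L)}} → ∀ {f : A → ℕ} {k} →
            k * total L ≤ ∑ L f → ∃ λ a → k ≤ f a
∑-attains L {f} {k} k≤ with search L
  where
  search : ∀ L → (∃ λ a → k ≤ f a) ⊎ ∑ L f + total L ≤ k * total L
  search [] = inj₂ z≤n
  search ((w , a) ∷ L) with k ≤? f a | search L
  ... | yes k≤fa | _       = inj₁ (a , k≤fa)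
  ... | no  k≰fa | inj₁ p  = inj₁ p
  ... | no  k≰fa | inj₂ ≤k = inj₂ (begin
      (w * f a + ∑ L f) + (w * 1 + total L)
        ≡⟨ solve 4 (λ w x s t → (w :* x :+ s) :+ (w :* con 1 :+ t) := w :* (con 1 :+ x) :+ (s :+ t))
             refl w (f a) (∑ L f) (total L) ⟩
      w * suc (f a) + (∑ L f + total L)
        ≤⟨ +-mono-≤ (*-monoʳ-≤ w (≰⇒> k≰fa)) ≤k ⟩
      w * k + k * total L
        ≡⟨ solve 3 (λ w k t → w :* k :+ k :* t := k :* (w :* con 1 :+ t)) refl w k (total L) ⟩
      k * (w * 1 + total L) ∎)
    where open ≤-Reasoning
... | inj₁ p  = p
... | inj₂ ≤k = contradiction (≤-trans ≤k k≤) (<⇒≱ (m<m+n _ (>-nonZero⁻¹ (total L))))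

module Expectation {C : Set} (c₀ : C) (L : List (ℕ × C)) .{{q≢0 : NonZero (total L)}} where

  -- Left unnormalised in order to stay in ℕ; the normaliser is `∥ M ∥`, the total weight of the
  -- outcomes of `M` coins.
  𝔼 : ∀ {M} → (Vec C M → ℕ) → ℕ
  𝔼 {zero}  f = f []
  𝔼 {suc M} f = ∑ L λ c → 𝔼 λ ω → f (c ∷ ω)

  ∥_∥ : ℕ → ℕ
  ∥ M ∥ = 𝔼 {M} λ _ → 1

  private variable
    M : ℕ

  𝔼-mono : {f g : Vec C M → ℕ} → (∀ ω → f ω ≤ g ω) → 𝔼 f ≤ 𝔼 g
  𝔼-mono {zero}  f≤g = f≤g []
  𝔼-mono {suc M} f≤g = ∑-mono L λ c → 𝔼-mono λ ω → f≤g (c ∷ ω)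

  𝔼-cong : {f g : Vec C M → ℕ} → (∀ ω → f ω ≡ g ω) → 𝔼 f ≡ 𝔼 g
  𝔼-cong {zero}  f≡g = f≡g []
  𝔼-cong {suc M} f≡g = ∑-cong L λ c → 𝔼-cong λ ω → f≡g (c ∷ ω)

  𝔼-+ : (f g : Vec C M → ℕ) → 𝔼 (λ ω → f ω + g ω) ≡ 𝔼 f + 𝔼 g
  𝔼-+ {zero}  f g = refl
  𝔼-+ {suc M} f g = trans (∑-cong L λ c → 𝔼-+ (λ ω → f (c ∷ ω)) (λ ω → g (c ∷ ω))) (∑-+ L _ _)

  𝔼-* : ∀ k (f : Vec C M → ℕ) → 𝔼 (λ ω → k * f ω) ≡ k * 𝔼 f
  𝔼-* {zero}  k f = refl
  𝔼-* {suc M} k f = trans (∑-cong L λ c → 𝔼-* k λ ω → f (c ∷ ω)) (∑-* L k _)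

  𝔼-const : ∀ k → 𝔼 {M} (λ _ → k) ≡ k * ∥ M ∥
  𝔼-const {M} k = trans (𝔼-cong {M} λ _ → sym (*-identityʳ k)) (𝔼-* {M} k λ _ → 1)

  ∥suc∥ : ∀ M → ∥ suc M ∥ ≡ ∥ M ∥ * total L
  ∥suc∥ M = ∑-const L ∥ M ∥

  ∥∥-nonZero : NonZero ∥ M ∥
  ∥∥-nonZero {zero}  = _
  ∥∥-nonZero {suc M} = subst NonZero (sym (∥suc∥ M)) (m*n≢0 ∥ M ∥ (total L) {{∥∥-nonZero {M}}})

  𝔼-attains : {f : Vec C M → ℕ} {k : ℕ} → k * ∥ M ∥ ≤ 𝔼 f → ∃ λ ω → k ≤ f ω
  𝔼-attains {zero}  {f} {k} k≤ = [] , subst (_≤ f []) (*-identityʳ k) k≤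
  𝔼-attains {suc M} {f} {k} k≤
    with c , k≤c ← ∑-attains L (subst (_≤ 𝔼 f) (trans (cong (k *_) (∥suc∥ M)) (sym (*-assoc k ∥ M ∥ (total L)))) k≤)
    with ω , k≤ω ← 𝔼-attains k≤c = (c ∷ ω) , k≤ω

  Ignores : (Vec C M → B) → Fin M → Set
  Ignores f j = ∀ ω c → f (ω [ j ]≔ c) ≡ f ω

  -- No coin influences both functions. This is stronger than independence of random variables, and
  -- it can be read off from supports.
  Independent : (f g : Vec C M → ℕ) → Set
  Independent f g = ∀ j → Ignores f j ⊎ Ignores g j

  𝔼-coordinate : (k : C → ℕ) (j : Fin M) → 𝔼 (λ ω → k (lookup ω j)) * total L ≡ ∥ M ∥ * ∑ L k
  𝔼-coordinate {suc M} k zero = begin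
    ∑ L (λ c → 𝔼 {M} λ _ → k c) * total L
      ≡⟨ cong (_* total L) (trans (∑-cong L λ c → trans (𝔼-const {M} (k c)) (*-comm (k c) ∥ M ∥)) (∑-* L ∥ M ∥ k)) ⟩
    ∥ M ∥ * ∑ L k * total L               ≡⟨ solve 3 (λ n s q → n :* s :* q := n :* q :* s) refl ∥ M ∥ (∑ L k) (total L) ⟩
    ∥ M ∥ * total L * ∑ L k               ≡⟨ cong (_* ∑ L k) (∥suc∥ M) ⟨
    ∥ suc M ∥ * ∑ L k                     ∎
    where open ≡-Reasoning
  𝔼-coordinate {suc M} k (suc j) = begin
    ∑ L (λ _ → e) * total L       ≡⟨ cong (_* total L) (∑-const L e) ⟩
    e * total L * total L         ≡⟨ cong (_* total L) (𝔼-coordinate k j) ⟩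
    ∥ M ∥ * ∑ L k * total L       ≡⟨ solve 3 (λ n s q → n :* s :* q := n :* q :* s) refl ∥ M ∥ (∑ L k) (total L) ⟩
    ∥ M ∥ * total L * ∑ L k       ≡⟨ cong (_* ∑ L k) (∥suc∥ M) ⟨
    ∥ suc M ∥ * ∑ L k             ∎
    where
    open ≡-Reasoning
    e = 𝔼 λ ω → k (lookup ω j)

  -- Induction on the coins. The first coin is ignored by one of the two functions; there its
  -- outcome may be fixed to `c₀`, and that expectation leaves the sum over the coin as a factor.
  𝔼-independent : (f g : Vec C M → ℕ) → Independent f g → 𝔼 f * 𝔼 g ≡ ∥ M ∥ * 𝔼 (λ ω → f ω * g ω)
  𝔼-independent {zero}  f g f⊥g = sym (*-identityˡ (f [] * g []))
  𝔼-independent {suc M} f g f⊥g = case-zero (f⊥g zero)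
    where
    open ≡-Reasoning

    slice : ∀ c c′ → Independent (λ ω → f (c ∷ ω)) (λ ω → g (c′ ∷ ω))
    slice c c′ j with f⊥g (suc j)
    ... | inj₁ fj = inj₁ λ ω → fj (c ∷ ω)
    ... | inj₂ gj = inj₂ λ ω → gj (c′ ∷ ω)

    F G : C → ℕ
    F c = 𝔼 λ ω → f (c ∷ ω)
    G c = 𝔼 λ ω → g (c ∷ ω)

    case-zero : Ignores f zero ⊎ Ignores g zero → 𝔼 f * 𝔼 g ≡ ∥ suc M ∥ * 𝔼 (λ ω → f ω * g ω)
    case-zero (inj₁ f0) = begin
      ∑ L F * ∑ L G
        ≡⟨ cong (_* ∑ L G) (trans (∑-cong L λ c → 𝔼-cong λ ω → f0 (c₀ ∷ ω) c) (∑-const L (F c₀))) ⟩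
      F c₀ * total L * ∑ L G
        ≡⟨ solve 3 (λ x q s → x :* q :* s := q :* (x :* s)) refl (F c₀) (total L) (∑ L G) ⟩
      total L * (F c₀ * ∑ L G)
        ≡⟨ cong (total L *_) (∑-* L (F c₀) G) ⟨
      total L * ∑ L (λ c → F c₀ * G c)
        ≡⟨ cong (total L *_) (∑-cong L λ c → trans (𝔼-independent _ _ (slice c₀ c))
             (cong (∥ M ∥ *_) (𝔼-cong λ ω → cong (_* g (c ∷ ω)) (sym (f0 (c₀ ∷ ω) c))))) ⟩
      total L * ∑ L (λ c → ∥ M ∥ * 𝔼 λ ω → f (c ∷ ω) * g (c ∷ ω))
        ≡⟨ cong (total L *_) (∑-* L ∥ M ∥ _) ⟩
      total L * (∥ M ∥ * 𝔼 (λ ω → f ω * g ω))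
        ≡⟨ solve 3 (λ q n s → q :* (n :* s) := n :* q :* s) refl (total L) ∥ M ∥ (𝔼 λ ω → f ω * g ω) ⟩
      ∥ M ∥ * total L * 𝔼 (λ ω → f ω * g ω)
        ≡⟨ cong (_* 𝔼 (λ ω → f ω * g ω)) (∥suc∥ M) ⟨
      ∥ suc M ∥ * 𝔼 (λ ω → f ω * g ω) ∎
    case-zero (inj₂ g0) = begin
      ∑ L F * ∑ L G
        ≡⟨ cong (∑ L F *_) (trans (∑-cong L λ c → 𝔼-cong λ ω → g0 (c₀ ∷ ω) c) (∑-const L (G c₀))) ⟩
      ∑ L F * (G c₀ * total L)
        ≡⟨ solve 3 (λ x q s → s :* (x :* q) := q :* (x :* s)) refl (G c₀) (total L) (∑ L F) ⟩
      total L * (G c₀ * ∑ L F)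
        ≡⟨ cong (total L *_) (∑-* L (G c₀) F) ⟨
      total L * ∑ L (λ c → G c₀ * F c)
        ≡⟨ cong (total L *_) (∑-cong L λ c → trans (*-comm (G c₀) (F c)) (trans (𝔼-independent _ _ (slice c c₀))
             (cong (∥ M ∥ *_) (𝔼-cong λ ω → cong (f (c ∷ ω) *_) (sym (g0 (c₀ ∷ ω) c)))))) ⟩
      total L * ∑ L (λ c → ∥ M ∥ * 𝔼 λ ω → f (c ∷ ω) * g (c ∷ ω))
        ≡⟨ cong (total L *_) (∑-* L ∥ M ∥ _) ⟩
      total L * (∥ M ∥ * 𝔼 (λ ω → f ω * g ω))
        ≡⟨ solve 3 (λ q n s → q :* (n :* s) := n :* q :* s) refl (total L) ∥ M ∥ (𝔼 λ ω → f ω * g ω) ⟩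
      ∥ M ∥ * total L * 𝔼 (λ ω → f ω * g ω)
        ≡⟨ cong (_* 𝔼 (λ ω → f ω * g ω)) (∥suc∥ M) ⟨
      ∥ suc M ∥ * 𝔼 (λ ω → f ω * g ω) ∎

  infix 4 _≽_/_

  -- The normalised expectation of f is at least p / d.
  record _≽_/_ {M} (f : Vec C M → ℕ) (p d : ℕ) : Set where
    constructor ≽-intro
    field ≽-elim : p * ∥ M ∥ ≤ d * 𝔼 f
  open _≽_/_ public

  private variable
    p r d e : ℕ

  ≽-mono : ∀ {M} {f g : Vec C M → ℕ} → (∀ ω → f ω ≤ g ω) → f ≽ p / d → g ≽ p / d
  ≽-mono {d = d} f≤g (≽-intro f≽) = ≽-intro (≤-trans f≽ (*-monoʳ-≤ d (𝔼-mono f≤g)))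

  ≽-weaken : ∀ {M} {f : Vec C M → ℕ} → r ≤ p → f ≽ p / d → f ≽ r / d
  ≽-weaken {M = M} r≤p (≽-intro f≽) = ≽-intro (≤-trans (*-monoˡ-≤ ∥ M ∥ r≤p) f≽)

  ≽-zero : ∀ {M} {f : Vec C M → ℕ} → f ≽ 0 / d
  ≽-zero = ≽-intro z≤n

  ≽-const : ∀ {M} k → _≽_/_ {M} (λ _ → k) (d * k) d
  ≽-const {d} {M} k = ≽-intro (≤-reflexive (trans (*-assoc d k ∥ M ∥) (cong (d *_) (sym (𝔼-const {M} k)))))

  ≽-+ : ∀ {M} {f g : Vec C M → ℕ} → f ≽ p / d → g ≽ r / d → (λ ω → f ω + g ω) ≽ p + r / d
  ≽-+ {p} {d} {r} {M} {f} {g} (≽-intro f≽) (≽-intro g≽) = ≽-intro (begin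
    (p + r) * ∥ M ∥          ≡⟨ *-distribʳ-+ ∥ M ∥ p r ⟩
    p * ∥ M ∥ + r * ∥ M ∥    ≤⟨ +-mono-≤ f≽ g≽ ⟩
    d * 𝔼 f + d * 𝔼 g        ≡⟨ *-distribˡ-+ d (𝔼 f) (𝔼 g) ⟨
    d * (𝔼 f + 𝔼 g)          ≡⟨ cong (d *_) (𝔼-+ f g) ⟨
    d * 𝔼 (λ ω → f ω + g ω)  ∎)
    where open ≤-Reasoning

  ≽-* : ∀ {M} {f g : Vec C M → ℕ} → Independent f g → f ≽ p / d → g ≽ r / e → (λ ω → f ω * g ω) ≽ p * r / (d * e)
  ≽-* {p} {d} {r} {e} {M} {f} {g} f⊥g (≽-intro f≽) (≽-intro g≽) = ≽-intro (*-cancelʳ-≤ _ _ ∥ M ∥ {{∥∥-nonZero {M}}} (begin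
    p * r * ∥ M ∥ * ∥ M ∥
      ≡⟨ solve 3 (λ p r n → p :* r :* n :* n := (p :* n) :* (r :* n)) refl p r ∥ M ∥ ⟩
    (p * ∥ M ∥) * (r * ∥ M ∥)
      ≤⟨ *-mono-≤ f≽ g≽ ⟩
    (d * 𝔼 f) * (e * 𝔼 g)
      ≡⟨ solve 4 (λ d x e y → (d :* x) :* (e :* y) := d :* e :* (x :* y)) refl d (𝔼 f) e (𝔼 g) ⟩
    d * e * (𝔼 f * 𝔼 g)
      ≡⟨ cong (d * e *_) (𝔼-independent f g f⊥g) ⟩
    d * e * (∥ M ∥ * 𝔼 (λ ω → f ω * g ω))
      ≡⟨ solve 3 (λ d n x → d :* (n :* x) := d :* x :* n) refl (d * e) ∥ M ∥ (𝔼 λ ω → f ω * g ω) ⟩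
    d * e * 𝔼 (λ ω → f ω * g ω) * ∥ M ∥ ∎))
    where open ≤-Reasoning

  ≽-coordinate : (k : C → ℕ) (j : Fin M) → (λ ω → k (lookup ω j)) ≽ ∑ L k / total L
  ≽-coordinate {M} k j = ≽-intro (≤-reflexive (trans (*-comm (∑ L k) ∥ M ∥)
    (trans (sym (𝔼-coordinate k j)) (*-comm _ (total L)))))

  ≽-cancel : ∀ {M} {f : Vec C M → ℕ} a .{{_ : NonZero a}} → f ≽ a * p / (a * d) → f ≽ p / d
  ≽-cancel {p} {d} {M} {f} a (≽-intro f≽) = ≽-intro (*-cancelˡ-≤ a (subst₂ _≤_ (*-assoc a p ∥ M ∥) (*-assoc a d (𝔼 f)) f≽))

  ≽-scale : ∀ {M} {f : Vec C M → ℕ} a → f ≽ p / d → f ≽ a * p / (a * d)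
  ≽-scale {p} {d} {M} {f} a (≽-intro f≽) = ≽-intro (subst₂ _≤_ (sym (*-assoc a p ∥ M ∥)) (sym (*-assoc a d (𝔼 f))) (*-monoʳ-≤ a f≽))

  ≽-mono-scaled : ∀ {M} {f g : Vec C M → ℕ} a b → (∀ ω → a * f ω ≤ b * g ω) → f ≽ p / d → g ≽ a * p / (b * d)
  ≽-mono-scaled {p} {d} {M} {f} {g} a b af≤bg (≽-intro f≽) = ≽-intro (begin
    a * p * ∥ M ∥             ≡⟨ *-assoc a p ∥ M ∥ ⟩
    a * (p * ∥ M ∥)           ≤⟨ *-monoʳ-≤ a f≽ ⟩
    a * (d * 𝔼 f)             ≡⟨ solve 3 (λ a d x → a :* (d :* x) := d :* (a :* x)) refl a d (𝔼 f) ⟩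
    d * (a * 𝔼 f)             ≡⟨ cong (d *_) (𝔼-* a f) ⟨
    d * 𝔼 (λ ω → a * f ω)     ≤⟨ *-monoʳ-≤ d (𝔼-mono af≤bg) ⟩
    d * 𝔼 (λ ω → b * g ω)     ≡⟨ cong (d *_) (𝔼-* b g) ⟩
    d * (b * 𝔼 g)             ≡⟨ solve 3 (λ b d x → d :* (b :* x) := b :* d :* x) refl b d (𝔼 g) ⟩
    b * d * 𝔼 g               ∎)
    where open ≤-Reasoning

-- Non-backtracking walks in graphs of large girth

module _ {A : Set} where

  prefix-unique : ∀ {x : A} ys {zs} → Unique (ys ++ x ∷ zs) → Unique (x ∷ ys)
  prefix-unique []       _           = [] ∷ []
  prefix-unique (y ∷ ys) (y∉ ∷ uniq) with x∉ys ∷ uniq′ ← prefix-unique ys uniq =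
    ((λ x≡y → All.head (++⁻ʳ ys y∉) (sym x≡y)) ∷ x∉ys) ∷ ++⁻ˡ ys y∉ ∷ uniq′

  prefix-linked : ∀ {_~_ : A → A → Set} {x y : A} ys {zs} →
                  Linked _~_ (x ∷ ys ++ y ∷ zs) → Linked _~_ (x ∷ ys ∷ʳ y)
  prefix-linked []        (x~y ∷ _)  = x~y ∷ [-]
  prefix-linked (_ ∷ ys)  (x~ ∷ ~ys) = x~ ∷ prefix-linked ys ~ys

module _ {n : ℕ} where
  open DecMembership (_≟_ {n}) using (_∈?_)

  _─_ : List (Fin n) → Fin n → List (Fin n)
  xs ─ x = filter (λ y → ¬? (y ≟ x)) xs

  ∉-─ : ∀ {x} xs → x ∉ xs → xs ─ x ≡ xs
  ∉-─ {x} xs x∉xs = filter-all (λ y → ¬? (y ≟ x)) (All.map (λ x≢y → x≢y ∘ sym) (¬Any⇒All¬ xs x∉xs))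

  sum-─ : ∀ (f : Fin n → ℕ) {x} {xs} → Unique xs → x ∈ xs → sum (map f xs) ≡ f x + sum (map f (xs ─ x))
  sum-─ f {x} {y ∷ xs} (y∉ ∷ uniq) x∈ with y ≟ x | x∈
  ... | yes refl | _          = cong (λ ys → f x + sum (map f ys)) (sym (∉-─ xs λ x∈xs → All.lookup y∉ x∈xs refl))
  ... | no  y≢x  | here x≡y   = contradiction (sym x≡y) y≢x
  ... | no  y≢x  | there x∈xs = begin
    f y + sum (map f xs)                ≡⟨ cong (f y +_) (sum-─ f uniq x∈xs) ⟩
    f y + (f x + sum (map f (xs ─ x)))  ≡⟨ +-assoc (f y) (f x) _ ⟨
    f y + f x + sum (map f (xs ─ x))    ≡⟨ cong (_+ sum (map f (xs ─ x))) (+-comm (f y) (f x)) ⟩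
    f x + f y + sum (map f (xs ─ x))    ≡⟨ +-assoc (f x) (f y) _ ⟩
    f x + (f y + sum (map f (xs ─ x)))  ∎
    where open ≡-Reasoning

  length-─ : ∀ {x} {xs} → Unique xs → x ∈ xs → length xs ≡ suc (length (xs ─ x))
  length-─ {x} {xs} uniq x∈xs =
    trans (sym (sum-ones xs)) (trans (sum-─ (λ _ → 1) uniq x∈xs) (cong suc (sum-ones (xs ─ x))))
    where
    sum-ones : ∀ (ys : List (Fin n)) → sum (map (λ _ → 1) ys) ≡ length ys
    sum-ones []       = refl
    sum-ones (y ∷ ys) = cong suc (sum-ones ys)

  module _ (G : Graph n) where
    open Graph G renaming (sym to adj-sym)

    infixr 5 _∷⟨_⟩_

    data NonBacktracking : List (Fin n) → Set where
      edge    : ∀ {u v} → Adj u v → NonBacktracking (u ∷ v ∷ [])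
      _∷⟨_⟩_  : ∀ {u v w p} → Adj u v → u ≢ w → NonBacktracking (v ∷ w ∷ p) → NonBacktracking (u ∷ v ∷ w ∷ p)

    linked : ∀ {p} → NonBacktracking p → Linked Adj p
    linked (edge uv)       = uv ∷ [-]
    linked (uv ∷⟨ _ ⟩ p)   = uv ∷ linked p

    -- If the tail is simple but the first vertex `u` recurs in it, the stretch up to the recurrence
    -- closes to a cycle. Length one is excluded by irreflexivity, length two by not backtracking.
    unique⊎cycle : ∀ {p} → NonBacktracking p → Unique p ⊎ ∃ λ C → cycleLength G C ≤ length p
    unique⊎cycle {u ∷ v ∷ []} (edge uv) = inj₁ (((λ u≡v → irrefl u≡v uv) ∷ []) ∷ [] ∷ [])
    unique⊎cycle {u ∷ p@(v ∷ w ∷ _)} up@(uv ∷⟨ u≢w ⟩ vp) with unique⊎cycle vp | u ∈? p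
    ... | inj₂ (C , C≤p) | _        = inj₂ (C , m≤n⇒m≤1+n C≤p)
    ... | inj₁ uniq      | no  u∉p  = inj₁ (¬Any⇒All¬ p u∉p ∷ uniq)
    ... | inj₁ uniq      | yes u∈p
      with ys , zs , p≡ ← ∈-∃++ u∈p = inj₂ (C , s≤s length-ys≤)
      where
      long : ∀ ys {zs} → v ∷ w ∷ _ ≡ ys ++ u ∷ zs → 3 ≤ length (u ∷ ys)
      long []           refl = contradiction uv (irrefl refl)
      long (_ ∷ [])     refl = contradiction refl u≢w
      long (_ ∷ _ ∷ ys) _    = s≤s (s≤s (s≤s z≤n))

      C : Cycle G
      C = record
        { start         = u
        ; rest          = ys
        ; distinct      = prefix-unique ys (subst Unique p≡ uniq)
        ; walk          = prefix-linked ys (subst (λ p → Linked Adj (u ∷ p)) p≡ (linked up))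
        ; nonDegenerate = long ys p≡
        }

      length-ys≤ : length ys ≤ length p
      length-ys≤ = subst (length ys ≤_) (trans (sym (length-++ ys)) (cong length (sym p≡))) (m≤m+n (length ys) _)

    others : Fin n → Fin n → List (Fin n)
    others u v = neighbours G u ─ v

    ∈neighbours : ∀ {u v} → Adj u v → v ∈ neighbours G u
    ∈neighbours {u} {v} uv = ∈-filter⁺ (adj? u) (∈-allFin v) uv

    ∈neighbours⁻ : ∀ {u v} → v ∈ neighbours G u → Adj u v
    ∈neighbours⁻ {u} v∈ = proj₂ (∈-filter⁻ (adj? u) {xs = allFin n} v∈)

    ∈others⁻ : ∀ {u v w} → w ∈ others u v → Adj u w × w ≢ v
    ∈others⁻ {u} {v} w∈ with w∈N , w≢v ← ∈-filter⁻ (λ y → ¬? (y ≟ v)) {xs = neighbours G u} w∈ = ∈neighbours⁻ w∈N , w≢v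

    neighbours-unique : ∀ u → Unique (neighbours G u)
    neighbours-unique u = filter⁺ (adj? u) (allFin⁺ n)

    record Others (u v : Fin n) : Set where
      field
        c₁ c₂   : Fin n
        others≡ : others u v ≡ c₁ ∷ c₂ ∷ []
        adj₁    : Adj u c₁
        adj₂    : Adj u c₂
        c₁≢v    : c₁ ≢ v
        c₂≢v    : c₂ ≢ v
        c₁≢c₂   : c₁ ≢ c₂

    two-others : Cubic G → ∀ {u v} → Adj u v → Others u v
    two-others cubic {u} {v} uv = two (others u v) refl
      (suc-injective (trans (sym (length-─ (neighbours-unique u) (∈neighbours uv))) (cubic u)))
      (filter⁺ (λ y → ¬? (y ≟ v)) (neighbours-unique u))
      where
      two : ∀ os → others u v ≡ os → length os ≡ 2 → Unique os → Others u v
      two (c₁ ∷ c₂ ∷ []) eq _ ((c₁≢c₂ ∷ []) ∷ _)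
        with uc₁ , c₁≢v ← ∈others⁻ (subst (c₁ ∈_) (sym eq) (here refl))
           | uc₂ , c₂≢v ← ∈others⁻ (subst (c₂ ∈_) (sym eq) (there (here refl)))
        = record { others≡ = eq ; adj₁ = uc₁ ; adj₂ = uc₂ ; c₁≢v = c₁≢v ; c₂≢v = c₂≢v ; c₁≢c₂ = c₁≢c₂ }

    -- The tree of walks that start at `u` and avoid stepping to `v`, cut off after `t` levels.
    -- These are the vertices whose coins `message t u v` may read.
    branch : ℕ → Fin n → Fin n → List (Fin n)
    branch zero    u v = []
    branch (suc t) u v = u ∷ concatMap (λ c → branch t c u) (others u v)

    branch-child : ∀ t {u v c w} → c ∈ others u v → w ∈ branch t c u → w ∈ branch (suc t) u v
    branch-child t {u} {c = c} c∈ w∈ = there (∈-concatMap⁺ (λ c → branch t c u) (lose c∈ w∈))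

    branch-cases : ∀ t {u v w} → w ∈ branch (suc t) u v → w ≡ u ⊎ ∃ λ c → c ∈ others u v × w ∈ branch t c u
    branch-cases t         (here w≡u) = inj₁ w≡u
    branch-cases t {u} {v} (there w∈) = inj₂ (find (∈-concatMap⁻ (λ c → branch t c u) {xs = others u v} w∈))

    branch-mono : ∀ t {u v w} → w ∈ branch t u v → w ∈ branch (suc t) u v
    branch-mono (suc t) w∈ with branch-cases t w∈
    ... | inj₁ w≡u           = here w≡u
    ... | inj₂ (c , c∈ , w∈) = branch-child (suc t) c∈ (branch-mono t w∈)

    branch-mono-≤ : ∀ {s t u v w} → s ≤ t → w ∈ branch s u v → w ∈ branch t u v
    branch-mono-≤ {s} {t} s≤t = go (≤⇒≤′ s≤t)
      where
      go : ∀ {t u v w} → s ≤′ t → w ∈ branch s u v → w ∈ branch t u v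
      go ≤′-refl           w∈ = w∈
      go (≤′-step {t} s≤t) w∈ = branch-mono t (go s≤t w∈)

    walk-into : ∀ t {u v w} → Adj v u → w ∈ branch t u v →
                ∃ λ p → NonBacktracking (v ∷ u ∷ p) × w ∈ u ∷ p × suc (length p) ≤ t
    walk-into (suc t) vu w∈ with branch-cases t w∈
    ... | inj₁ w≡u = [] , edge vu , here w≡u , s≤s z≤n
    ... | inj₂ (c , c∈ , w∈) with uc , c≢v ← ∈others⁻ c∈ with p , up , w∈p , p≤ ← walk-into t uc w∈ =
      c ∷ p , vu ∷⟨ c≢v ∘ sym ⟩ up , there w∈p , s≤s p≤

    -- Glues a route through a branch to the front of a given walk. A vertex lying in two branches
    -- thus yields a walk that meets its own start again.
    extend-into : ∀ t {u v w p} → NonBacktracking (u ∷ v ∷ p) → w ∈ branch t u v →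
                  ∃ λ r → NonBacktracking (w ∷ r) × (∀ {x} → x ∈ v ∷ p → x ∈ r) × length r ≤ t + length p
    extend-into (suc t) {v = v} {p = p} uvp w∈ with branch-cases t w∈
    ... | inj₁ refl = v ∷ p , uvp , (λ x∈ → x∈) , s≤s (m≤n+m (length p) t)
    ... | inj₂ (c , c∈ , w∈) with uc , c≢v ← ∈others⁻ c∈
      with r , wr , ⊆r , r≤ ← extend-into t (adj-sym uc ∷⟨ c≢v ⟩ uvp) w∈ =
      r , wr , ⊆r ∘ there , subst (length r ≤_) (+-suc t (length p)) r≤

    module Locality (T : ℕ) (girth : ∀ C → 2 + (T + T) ≤ cycleLength G C) where

      short-unique : ∀ {p} → NonBacktracking p → length p ≤ 1 + (T + T) → Unique p
      short-unique p short with unique⊎cycle p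
      ... | inj₁ uniq      = uniq
      ... | inj₂ (C , C≤p) = contradiction (≤-trans (girth C) (≤-trans C≤p short)) (<-irrefl refl)

      revisit-far : ∀ {w r} → NonBacktracking (w ∷ r) → w ∈ r → T + T < length r
      revisit-far {w} {r} wr w∈r with length r ≤? T + T
      ... | no  r≰ = ≰⇒> r≰
      ... | yes r≤ with w∉ ∷ _ ← short-unique wr (s≤s r≤) = contradiction refl (All.lookup w∉ w∈r)

      centre∉branch : ∀ {t u v} → t ≤ T → Adj v u → v ∉ branch t u v
      centre∉branch t≤T vu v∈ with p , vup , v∈p , p≤ ← walk-into _ vu v∈ =
        <⇒≱ (revisit-far vup v∈p) (≤-trans p≤ (≤-trans t≤T (m≤m+n T T)))

      -- A common vertex `w` gives a walk from `w` through `c′`, `u`, `c` back to `w`. It does not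
      -- backtrack at `u` because `c ≢ c′`, and with at most `2T` edges it is too short to return.
      siblings-disjoint : ∀ {t u c c′ w} → t ≤ T → Adj u c → Adj u c′ → c ≢ c′ →
                          w ∈ branch t c u → w ∈ branch t c′ u → ⊥
      siblings-disjoint t≤T uc uc′ c≢c′ w∈ w∈′
        with p , ucp , w∈p , p≤ ← walk-into _ uc w∈
        with r , wr , ⊆r , r≤ ← extend-into _ (adj-sym uc′ ∷⟨ c≢c′ ∘ sym ⟩ ucp) w∈′ =
        <⇒≱ (revisit-far wr (⊆r (there w∈p))) (≤-trans r≤ (+-mono-≤ t≤T (≤-trans p≤ t≤T)))

      opposite-disjoint : ∀ {t u v w} → t ≤ T → Adj u v → w ∈ branch t u v → w ∈ branch t v u → ⊥
      opposite-disjoint t≤T uv w∈ w∈′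
        with p , vup , w∈p , p≤ ← walk-into _ (adj-sym uv) w∈
        with r , wr , ⊆r , r≤ ← extend-into _ vup w∈′ =
        <⇒≱ (revisit-far wr (⊆r w∈p)) (≤-trans r≤ (+-mono-≤ t≤T (≤-trans (n≤1+n _) (≤-trans p≤ t≤T))))

-- The colouring process

data Status : Set where
  blank red blue : Status

δ : Status → Status → ℕ
δ blank blank = 1
δ red   red   = 1
δ blue  blue  = 1
δ _     _     = 0

opp : Status → Status → ℕ
opp red  blue = 1
opp blue red  = 1
opp _    _    = 0

#red #blue : Status → ℕ
#red  = δ red
#blue = δ blue

-- Sums over statuses and over triples of histories

opaque
  Σˢ : (Status → ℕ) → ℕ
  Σˢ f = f blank + f red + f blue

  Σˢ-cong : ∀ {f g : Status → ℕ} → (∀ s → f s ≡ g s) → Σˢ f ≡ Σˢ g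
  Σˢ-cong f≡g = cong₂ _+_ (cong₂ _+_ (f≡g blank) (f≡g red)) (f≡g blue)

  Σˢ-mono : ∀ {f g : Status → ℕ} → (∀ s → f s ≤ g s) → Σˢ f ≤ Σˢ g
  Σˢ-mono f≤g = +-mono-≤ (+-mono-≤ (f≤g blank) (f≤g red)) (f≤g blue)

  Σˢ-* : ∀ k (f : Status → ℕ) → Σˢ (λ s → k * f s) ≡ k * Σˢ f
  Σˢ-* k f = solve 4 (λ k x y z → k :* x :+ k :* y :+ k :* z := k :* (x :+ y :+ z)) refl k (f blank) (f red) (f blue)

  Σˢ-swap : ∀ (f : Status → Status → ℕ) → Σˢ (λ a → Σˢ (f a)) ≡ Σˢ λ b → Σˢ λ a → f a b
  Σˢ-swap f = solve 9 (λ x₁ x₂ x₃ y₁ y₂ y₃ z₁ z₂ z₃ →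
      (x₁ :+ x₂ :+ x₃) :+ (y₁ :+ y₂ :+ y₃) :+ (z₁ :+ z₂ :+ z₃) :=
      (x₁ :+ y₁ :+ z₁) :+ (x₂ :+ y₂ :+ z₂) :+ (x₃ :+ y₃ :+ z₃))
    refl (f blank blank) (f blank red) (f blank blue) (f red blank) (f red red) (f red blue) (f blue blank) (f blue red) (f blue blue)

  Σˢ-δ : ∀ s (f : Status → ℕ) → Σˢ (λ s′ → δ s s′ * f s′) ≡ f s
  Σˢ-δ blank f = trans (+-identityʳ _) (trans (+-identityʳ _) (*-identityˡ _))
  Σˢ-δ red   f = trans (+-identityʳ _) (*-identityˡ _)
  Σˢ-δ blue  f = *-identityˡ _

Σ³ : (Status → Status → Status → ℕ) → ℕ
Σ³ f = Σˢ λ a → Σˢ λ b → Σˢ λ c → f a b c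

Σ³-swap : ∀ (f : Status → Status → Status → Status → Status → Status → ℕ) →
          Σ³ (λ a b c → Σ³ λ a′ b′ c′ → f a b c a′ b′ c′) ≡ Σ³ λ a′ b′ c′ → Σ³ λ a b c → f a b c a′ b′ c′
Σ³-swap f = begin
  (Σ³ λ a b c → Σ³ λ a′ b′ c′ → f a b c a′ b′ c′)
    ≡⟨ Σ³-Σˢ (λ a b c a′ → Σˢ λ b′ → Σˢ λ c′ → f a b c a′ b′ c′) ⟩
  (Σˢ λ a′ → Σ³ λ a b c → Σˢ λ b′ → Σˢ λ c′ → f a b c a′ b′ c′)
    ≡⟨ Σˢ-cong (λ a′ → Σ³-Σˢ λ a b c b′ → Σˢ λ c′ → f a b c a′ b′ c′) ⟩
  (Σˢ λ a′ → Σˢ λ b′ → Σ³ λ a b c → Σˢ λ c′ → f a b c a′ b′ c′)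
    ≡⟨ Σˢ-cong (λ a′ → Σˢ-cong λ b′ → Σ³-Σˢ λ a b c c′ → f a b c a′ b′ c′) ⟩
  (Σ³ λ a′ b′ c′ → Σ³ λ a b c → f a b c a′ b′ c′) ∎
  where
  open ≡-Reasoning
  Σ³-Σˢ : ∀ (f : Status → Status → Status → Status → ℕ) →
          Σ³ (λ a b c → Σˢ λ s → f a b c s) ≡ Σˢ λ s → Σ³ λ a b c → f a b c s
  Σ³-Σˢ f = trans (Σˢ-cong λ a → trans (Σˢ-cong λ b → Σˢ-swap (f a b)) (Σˢ-swap λ b s → Σˢ λ c → f a b c s))
                  (Σˢ-swap λ a s → Σˢ λ b → Σˢ λ c → f a b c s)

Σ³-cong : ∀ {f g : Status → Status → Status → ℕ} → (∀ a b c → f a b c ≡ g a b c) → Σ³ f ≡ Σ³ g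
Σ³-cong f≡g = Σˢ-cong λ a → Σˢ-cong λ b → Σˢ-cong λ c → f≡g a b c

Σ³-mono : ∀ {f g : Status → Status → Status → ℕ} → (∀ a b c → f a b c ≤ g a b c) → Σ³ f ≤ Σ³ g
Σ³-mono f≤g = Σˢ-mono λ a → Σˢ-mono λ b → Σˢ-mono λ c → f≤g a b c

Σ³-* : ∀ k (f : Status → Status → Status → ℕ) → Σ³ (λ a b c → k * f a b c) ≡ k * Σ³ f
Σ³-* k f = trans (Σˢ-cong λ a → trans (Σˢ-cong λ b → Σˢ-* k (f a b)) (Σˢ-* k _)) (Σˢ-* k _)

Σ³-δ : ∀ s₁ s₂ s₃ (f : Status → Status → Status → ℕ) → Σ³ (λ a b c → δ s₁ a * (δ s₂ b * (δ s₃ c * f a b c))) ≡ f s₁ s₂ s₃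
Σ³-δ s₁ s₂ s₃ f = begin
  (Σ³ λ a b c → δ s₁ a * (δ s₂ b * (δ s₃ c * f a b c)))
    ≡⟨ Σˢ-cong (λ a → trans (Σˢ-cong λ b → trans (Σˢ-* (δ s₁ a) _) (cong (δ s₁ a *_)
         (trans (Σˢ-* (δ s₂ b) _) (cong (δ s₂ b *_) (Σˢ-δ s₃ (f a b)))))) (Σˢ-* (δ s₁ a) _)) ⟩
  (Σˢ λ a → δ s₁ a * Σˢ λ b → δ s₂ b * f a b s₃)
    ≡⟨ Σˢ-cong (λ a → cong (δ s₁ a *_) (Σˢ-δ s₂ λ b → f a b s₃)) ⟩
  (Σˢ λ a → δ s₁ a * f a s₂ s₃)
    ≡⟨ Σˢ-δ s₁ (λ a → f a s₂ s₃) ⟩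
  f s₁ s₂ s₃ ∎
  where open ≡-Reasoning

-- A history lists the statuses at times t, …, 1; at time 0 everything is blank.
History : ℕ → Set
History = Vec Status

last : ∀ {t} → History t → Status
last []      = blank
last (s ∷ _) = s

-- The latest statuses are summed innermost, so that the last step of all three histories can be
-- split off together.
∑ʰ : ∀ t → (History t → History t → History t → ℕ) → ℕ
∑ʰ zero    F = F [] [] []
∑ʰ (suc t) F = ∑ʰ t λ x y z → Σ³ λ a b c → F (a ∷ x) (b ∷ y) (c ∷ z)

∑ʰ-cong : ∀ t {F H} → (∀ x y z → F x y z ≡ H x y z) → ∑ʰ t F ≡ ∑ʰ t H
∑ʰ-cong zero    F≡H = F≡H [] [] []
∑ʰ-cong (suc t) F≡H = ∑ʰ-cong t λ x y z → Σ³-cong λ a b c → F≡H (a ∷ x) (b ∷ y) (c ∷ z)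

decide : Status → Status → Status
decide blank s = s
decide s     _ = s

decide-blank : ∀ {s s′} → decide s s′ ≡ blank → s ≡ blank
decide-blank {blank} _ = refl

-- Weights of histories are scaled by D at each step. Staying blank costs nothing
-- here: the probability ν of having stayed blank so far is paid by mass, at the end.
module _ (D : ℕ) where

  transition : (Status → ℕ) → Status → Status → ℕ
  transition r blank blank = D
  transition r blank s     = r s
  transition r red   red   = D
  transition r blue  blue  = D
  transition r _     _     = 0

  mass : ℕ → Status → ℕ
  mass ν blank = ν
  mass ν _     = D

  -- The law of a neighbour which is kept blank.
  blank-mass : Status → ℕ
  blank-mass blank = D
  blank-mass _     = 0

reaction : ∀ {C : Set} → (ℕ → C → ℕ → ℕ → Status) → ℕ → C → Status → Status → Status → Status
reaction act t k a b c = act t k (#red a + (#red b + #red c)) (#blue a + (#blue b + #blue c))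

-- Statuses, messages and the coins they read

module Process
  {C : Set} (c₀ : C) (L : List (ℕ × C)) .{{_ : NonZero (total L)}}
  (act : ℕ → C → ℕ → ℕ → Status)
  (T : ℕ) .{{_ : NonZero T}}
  {n : ℕ} (G : Graph n) (cubic : Cubic G)
  where

  open Graph G using (Adj) renaming (sym to adj-sym)
  open Expectation c₀ L public
  open DecMembership (_≟_ {n}) using (_∈?_)

  react : ℕ → C → Status → Status → Status → Status
  react = reaction act

  Ω : Set
  Ω = Vec C (n * T)

  -- The reduction modulo `T` only makes the index total; the rounds that matter are below `T`,
  -- where different rounds have different coins.
  coord : Fin n → ℕ → Fin (n * T)
  coord v t = combine v (t mod T)

  coin : Ω → Fin n → ℕ → C
  coin ω v t = lookup ω (coord v t)

  count : (Status → ℕ) → (Fin n → Status) → List (Fin n) → ℕ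
  count # f xs = sum (map (#  ∘ f) xs)

  status : ℕ → Fin n → Ω → Status
  status zero    v ω = blank
  status (suc t) v ω = decide (status t v ω) (act t (coin ω v t) (count #red f (neighbours G v)) (count #blue f (neighbours G v)))
    where
    f : Fin n → Status
    f c = status t c ω

  -- The status of u in the process in which v is kept blank.
  message : ℕ → Fin n → Fin n → Ω → Status
  message zero    u v ω = blank
  message (suc t) u v ω = decide (message t u v ω) (act t (coin ω u t) (count #red f (others G u v)) (count #blue f (others G u v)))
    where
    f : Fin n → Status
    f c = message t c u ω

  module _ {u v : Fin n} (uv : Adj u v) where
    open Others (two-others G cubic uv)

    message-step : ∀ t ω → message (suc t) u v ω ≡
      decide (message t u v ω) (react t (coin ω u t) (message t c₁ u ω) (message t c₂ u ω) blank)
    message-step t ω = cong (λ os → decide (message t u v ω) (act t (coin ω u t)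
      (count #red (λ c → message t c u ω) os) (count #blue (λ c → message t c u ω) os))) others≡

    status-step : ∀ t ω → status (suc t) u ω ≡
      decide (status t u ω) (react t (coin ω u t) (status t c₁ ω) (status t c₂ ω) (status t v ω))
    status-step t ω = cong₂ (λ r b → decide (status t u ω) (act t (coin ω u t) r b)) (count≡ #red) (count≡ #blue)
      where
      f : Fin n → Status
      f c = status t c ω

      count≡ : ∀ # → count # f (neighbours G u) ≡ # (f c₁) + (# (f c₂) + # (f v))
      count≡ # = begin
        count # f (neighbours G u)             ≡⟨ sum-─ (# ∘ f) (neighbours-unique G u) (∈neighbours G uv) ⟩
        # (f v) + count # f (others G u v)     ≡⟨ cong (λ os → # (f v) + count # f os) others≡ ⟩
        # (f v) + (# (f c₁) + (# (f c₂) + 0))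
          ≡⟨ solve 3 (λ x y z → z :+ (x :+ (y :+ con 0)) := x :+ (y :+ z)) refl (# (f c₁)) (# (f c₂)) (# (f v)) ⟩
        # (f c₁) + (# (f c₂) + # (f v))        ∎
        where open ≡-Reasoning

  -- A blank `v` has always been blank, and so never influenced `u`. The form for `suc t` asks for a
  -- blank `v` at time `t` only, since round `t` reads the statuses of time `t`; it covers the round
  -- in which `v` itself is coloured.
  status-message : ∀ t {u v ω} → Adj u v → status t v ω ≡ blank → status t u ω ≡ message t u v ω
  status-message-suc : ∀ t {u v ω} → Adj u v → status t v ω ≡ blank → status (suc t) u ω ≡ message (suc t) u v ω

  status-message zero    uv _  = refl
  status-message (suc t) uv v○ = status-message-suc t uv (decide-blank v○)

  status-message-suc t {u} {v} {ω} uv v○ = begin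
    status (suc t) u ω
      ≡⟨ status-step uv t ω ⟩
    decide (status t u ω) (react t (coin ω u t) (status t c₁ ω) (status t c₂ ω) (status t v ω))
      ≡⟨ same (status t u ω) refl ⟩
    decide (status t u ω) (react t (coin ω u t) (message t c₁ u ω) (message t c₂ u ω) blank)
      ≡⟨ cong (λ s → decide s (react t (coin ω u t) (message t c₁ u ω) (message t c₂ u ω) blank)) (status-message t uv v○) ⟩
    decide (message t u v ω) (react t (coin ω u t) (message t c₁ u ω) (message t c₂ u ω) blank)
      ≡⟨ message-step uv t ω ⟨
    message (suc t) u v ω ∎
    where
    open ≡-Reasoning
    open Others (two-others G cubic uv)
    same : ∀ s → status t u ω ≡ s →
           decide s (react t (coin ω u t) (status t c₁ ω) (status t c₂ ω) (status t v ω)) ≡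
           decide s (react t (coin ω u t) (message t c₁ u ω) (message t c₂ u ω) blank)
    -- A coloured `u` no longer reacts. For a blank `u`, the claim at time `t` applies to the
    -- messages that its other neighbours send to `u`.
    same red   _ = refl
    same blue  _ = refl
    same blank u○ rewrite status-message t {ω = ω} (adj-sym adj₁) u○ | status-message t {ω = ω} (adj-sym adj₂) u○ | v○ = refl

  -- Each message is faithful as long as the other end is blank, so neither end can be the first to
  -- deviate from its message.
  messages-blank : ∀ t {u v ω} → Adj u v → message t u v ω ≡ blank → message t v u ω ≡ blank →
                   status t u ω ≡ blank × status t v ω ≡ blank
  messages-blank zero    uv _  _  = refl , refl
  messages-blank (suc t) uv u○ v○ with u○′ , v○′ ← messages-blank t uv (decide-blank u○) (decide-blank v○) =
    trans (status-message-suc t uv v○′) u○ , trans (status-message-suc t (adj-sym uv) u○′) v○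

  coord-injectiveˡ : ∀ {u v t} {i : Fin T} → coord u t ≡ combine v i → u ≡ v
  coord-injectiveˡ {u} {v} {t} {i} = combine-injectiveˡ u (t mod T) v i

  coord-injectiveʳ : ∀ {v s t} → s < T → t < T → coord v s ≡ coord v t → s ≡ t
  coord-injectiveʳ {v} {s} {t} s<T t<T eq = begin
    s             ≡⟨ toℕ-mod s<T ⟨
    toℕ (s mod T) ≡⟨ cong toℕ (combine-injectiveʳ v (s mod T) v (t mod T) eq) ⟩
    toℕ (t mod T) ≡⟨ toℕ-mod t<T ⟩
    t             ∎
    where
    open ≡-Reasoning
    toℕ-mod : ∀ {t} → t < T → toℕ (t mod T) ≡ t
    toℕ-mod {t} t<T = trans (toℕ-fromℕ< (m%n<n t T)) (m<n⇒m%n≡m t<T)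

  Within : (Ω → A) → List (Fin n) → Set
  Within f b = ∀ {w} → w ∉ b → ∀ i → Ignores f (combine w i)

  within-⊆ : ∀ {f : Ω → A} {b b′} → (∀ {w} → w ∈ b → w ∈ b′) → Within f b → Within f b′
  within-⊆ b⊆b′ fb w∉b′ = fb (w∉b′ ∘ b⊆b′)

  within-* : ∀ {f g : Ω → ℕ} {b b′} → Within f b → Within g b′ → Within (λ ω → f ω * g ω) (b ++ b′)
  within-* {b = b} fb gb′ w∉ i ω c = cong₂ _*_ (fb (w∉ ∘ ∈-++⁺ˡ) i ω c) (gb′ (w∉ ∘ ∈-++⁺ʳ b) i ω c)

  within-coin : ∀ v t → Within (λ ω → coin ω v t) (v ∷ [])
  within-coin v t w∉ i ω c = lookup∘update′ (λ eq → w∉ (here (sym (coord-injectiveˡ {t = t} eq)))) ω c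

  Disjoint : (b b′ : List (Fin n)) → Set
  Disjoint b b′ = ∀ {w} → w ∈ b → w ∈ b′ → ⊥

  disjoint-++ : ∀ {b} b′ {b″} → Disjoint b b′ → Disjoint b b″ → Disjoint b (b′ ++ b″)
  disjoint-++ b′ d′ d″ w∈ w∈′ = [ d′ w∈ , d″ w∈ ]′ (∈-++⁻ b′ w∈′)

  within-independent : ∀ {f g : Ω → ℕ} {b b′} → Within f b → Within g b′ → Disjoint b b′ → Independent f g
  within-independent {b = b} fb gb′ disj j with w , i , refl ← combine-surjective {n} {T} j with w ∈? b
  ... | yes w∈b = inj₂ (gb′ (disj w∈b) i)
  ... | no  w∉b = inj₁ (fb w∉b i)

  count-cong : ∀ # {f g : Fin n → Status} xs → (∀ {c} → c ∈ xs → f c ≡ g c) → count # f xs ≡ count # g xs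
  count-cong # []       f≡g = refl
  count-cong # (x ∷ xs) f≡g = cong₂ _+_ (cong # (f≡g (here refl))) (count-cong # xs (f≡g ∘ there))

  within-message : ∀ t u v → Within (message t u v) (branch G t u v)
  within-message zero    u v w∉ i ω c = refl
  within-message (suc t) u v {w} w∉ i ω c = cong₂ decide (within-message t u v (w∉ ∘ branch-mono G t) i ω c)
    (trans (cong (λ k → act t k (count #red f′ (others G u v)) (count #blue f′ (others G u v)))
             (within-coin u t (λ { (here w≡u) → w∉ (here w≡u) }) i ω c))
           (cong₂ (act t (coin ω u t)) (count-cong #red (others G u v) children) (count-cong #blue (others G u v) children)))
    where
    f′ : Fin n → Status
    f′ c′ = message t c′ u (ω [ combine w i ]≔ c)

    children : ∀ {c′} → c′ ∈ others G u v → message t c′ u (ω [ combine w i ]≔ c) ≡ message t c′ u ω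
    children {c′} c′∈ = within-message t c′ u (w∉ ∘ branch-child G t c′∈) i ω c

-- Joint estimates for the three neighbours of a blank vertex

module Estimate
  {C : Set} (c₀ : C) (L : List (ℕ × C)) .{{q≢0 : NonZero (total L)}}
  (act : ℕ → C → ℕ → ℕ → Status)
  (T : ℕ) .{{T≢0 : NonZero T}}
  (D : ℕ) (r : ℕ → Status → ℕ)
  {n : ℕ} (G : Graph n) (cubic : Cubic G)
  where

  open Process c₀ L act T G cubic

  q : ℕ
  q = total L

  opaque
    unfolding Σˢ

    ≽-Σˢ : ∀ {f : Status → Ω → ℕ} {p d} → (∀ s → f s ≽ p s / d) → (λ ω → Σˢ λ s → f s ω) ≽ Σˢ p / d
    ≽-Σˢ {p = p} f≽ = ≽-+ {p = p blank + p red} (≽-+ (f≽ blank) (f≽ red)) (f≽ blue)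

  ≽-∑ʰ : ∀ t {f : History t → History t → History t → Ω → ℕ} {p d} → (∀ x y z → f x y z ≽ p x y z / d) →
         (λ ω → ∑ʰ t λ x y z → f x y z ω) ≽ ∑ʰ t p / d
  ≽-∑ʰ zero    f≽ = f≽ [] [] []
  ≽-∑ʰ (suc t) f≽ = ≽-∑ʰ t λ x y z → ≽-Σˢ λ a → ≽-Σˢ λ b → ≽-Σˢ λ c → f≽ (a ∷ x) (b ∷ y) (c ∷ z)

  Trajectory : Set
  Trajectory = ℕ → Ω → Status

  history : ∀ t → Trajectory → Ω → History t
  history zero    s ω = []
  history (suc t) s ω = s (suc t) ω ∷ history t s ω

  last-history : ∀ t (s : Trajectory) {ω} → s 0 ω ≡ blank → last (history t s ω) ≡ s t ω
  last-history zero    s s₀ = sym s₀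
  last-history (suc t) s s₀ = refl

  follows : ∀ t → Trajectory → History t → Ω → ℕ
  follows zero    s []      ω = 1
  follows (suc t) s (a ∷ x) ω = δ (s (suc t) ω) a * follows t s x ω

  -- Each outcome realises exactly one triple of histories, so the indicators form a partition of
  -- unity.
  ∑ʰ-follows : ∀ t (s₁ s₂ s₃ : Trajectory) ω (F : History t → History t → History t → ℕ) →
    ∑ʰ t (λ x y z → follows t s₁ x ω * (follows t s₂ y ω * (follows t s₃ z ω * F x y z))) ≡
    F (history t s₁ ω) (history t s₂ ω) (history t s₃ ω)
  ∑ʰ-follows zero    s₁ s₂ s₃ ω F = trans (+-identityʳ _) (trans (+-identityʳ _) (+-identityʳ _))
  ∑ʰ-follows (suc t) s₁ s₂ s₃ ω F = trans (∑ʰ-cong t step) (∑ʰ-follows t s₁ s₂ s₃ ω _)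
    where
    open ≡-Reasoning
    step : ∀ x y z → _ ≡ follows t s₁ x ω * (follows t s₂ y ω * (follows t s₃ z ω *
                          F (s₁ (suc t) ω ∷ x) (s₂ (suc t) ω ∷ y) (s₃ (suc t) ω ∷ z)))
    step x y z = begin
      (Σ³ λ a b c → (δ (s₁ (suc t) ω) a * p₁) * ((δ (s₂ (suc t) ω) b * p₂) * ((δ (s₃ (suc t) ω) c * p₃) * F (a ∷ x) (b ∷ y) (c ∷ z))))
        ≡⟨ Σ³-cong (λ a b c → solve 7 (λ d e f p q r g → (d :* p) :* ((e :* q) :* ((f :* r) :* g))
                    := d :* (e :* (f :* (p :* (q :* (r :* g))))))
             refl (δ (s₁ (suc t) ω) a) (δ (s₂ (suc t) ω) b) (δ (s₃ (suc t) ω) c) p₁ p₂ p₃ (F (a ∷ x) (b ∷ y) (c ∷ z))) ⟩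
      (Σ³ λ a b c → δ (s₁ (suc t) ω) a * (δ (s₂ (suc t) ω) b * (δ (s₃ (suc t) ω) c * (p₁ * (p₂ * (p₃ * F (a ∷ x) (b ∷ y) (c ∷ z)))))))
        ≡⟨ Σ³-δ (s₁ (suc t) ω) (s₂ (suc t) ω) (s₃ (suc t) ω) (λ a b c → p₁ * (p₂ * (p₃ * F (a ∷ x) (b ∷ y) (c ∷ z)))) ⟩
      p₁ * (p₂ * (p₃ * F (s₁ (suc t) ω ∷ x) (s₂ (suc t) ω ∷ y) (s₃ (suc t) ω ∷ z))) ∎
      where
      p₁ = follows t s₁ x ω
      p₂ = follows t s₂ y ω
      p₃ = follows t s₃ z ω

  -- The indicator that v is still blank at time t when its neighbours have histories x, y and z.
  alive : ∀ t → Fin n → History t → History t → History t → Ω → ℕ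
  alive zero    v x       y       z       ω = 1
  alive (suc t) v (_ ∷ x) (_ ∷ y) (_ ∷ z) ω =
    δ (react t (coin ω v t) (last x) (last y) (last z)) blank * alive t v x y z ω

  κ : ℕ → Status → Status → Status → ℕ
  κ t a b c = ∑ L λ k → δ (react t k a b c) blank

  survival : ∀ t → History t → History t → History t → ℕ
  survival zero    x       y       z       = 1
  survival (suc t) (_ ∷ x) (_ ∷ y) (_ ∷ z) = κ t (last x) (last y) (last z) * survival t x y z

  alive-ignores : ∀ t v x y z {j} → (∀ i → i < t → coord v i ≢ j) → Ignores (alive t v x y z) j
  alive-ignores zero    v x       y       z       j∉ ω c = refl
  alive-ignores (suc t) v (_ ∷ x) (_ ∷ y) (_ ∷ z) j∉ ω c = cong₂ _*_
    (cong (λ k → δ (react t k (last x) (last y) (last z)) blank) (lookup∘update′ (j∉ t ≤-refl) ω c))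
    (alive-ignores t v x y z (λ i i<t → j∉ i (m<n⇒m<1+n i<t)) ω c)

  within-alive : ∀ t v x y z → Within (alive t v x y z) (v ∷ [])
  within-alive t v x y z w∉ i =
    alive-ignores t v x y z λ s _ eq → w∉ (here (sym (coord-injectiveˡ {t = s} eq)))

  -- `alive t` reads the coins of `v` from rounds before `t` only, and `t < T` keeps these apart
  -- from the coin of round `t`.
  coin-alive-independent : ∀ (h : C → ℕ) {t} v x y z → t < T → Independent (λ ω → h (coin ω v t)) (alive t v x y z)
  coin-alive-independent h {t} v x y z t<T j with coord v t ≟ j
  ... | yes refl = inj₂ (alive-ignores t v x y z λ i i<t eq → <⇒≢ i<t (coord-injectiveʳ (<-trans i<t t<T) t<T eq))
  ... | no  ≢j   = inj₁ λ ω c → cong h (lookup∘update′ ≢j ω c)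

  alive-≽ : ∀ {t} v x y z → t ≤ T → alive t v x y z ≽ survival t x y z / (q ^ t)
  alive-≽ {zero}  v x       y       z       _   = ≽-const {d = 1} 1
  alive-≽ {suc t} v (_ ∷ x) (_ ∷ y) (_ ∷ z) t<T =
    ≽-* {p = κ t (last x) (last y) (last z)}
      (coin-alive-independent (λ k → δ (react t k (last x) (last y) (last z)) blank) v x y z t<T)
      (≽-coordinate (λ k → δ (react t k (last x) (last y) (last z)) blank) (coord v t))
      (alive-≽ v x y z (<⇒≤ t<T))

  -- Stated for any trajectory `s` that obeys the reaction while blank, so that it serves both the
  -- status of a vertex and a message sent by it.
  alive-≤ : ∀ t v {s₁ s₂ s₃ : Trajectory} {ω} → s₁ 0 ω ≡ blank → s₂ 0 ω ≡ blank → s₃ 0 ω ≡ blank →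
            ∀ {s : ℕ → Status} → s 0 ≡ blank →
            (∀ i → s i ≡ blank → s (suc i) ≡ react i (coin ω v i) (s₁ i ω) (s₂ i ω) (s₃ i ω)) →
            alive t v (history t s₁ ω) (history t s₂ ω) (history t s₃ ω) ω ≤ δ (s t) blank
  alive-≤ zero    v z₁ z₂ z₃ {s} s₀ step rewrite s₀ = ≤-refl
  alive-≤ (suc t) v {s₁} {s₂} {s₃} {ω} z₁ z₂ z₃ {s} s₀ step
    rewrite last-history t s₁ z₁ | last-history t s₂ z₂ | last-history t s₃ z₃
    with s t in s≡ | alive-≤ t v {s₁} {s₂} {s₃} {ω} z₁ z₂ z₃ {s} s₀ step
  ... | blank | ≤1 rewrite step t s≡ = ≤-trans (*-monoʳ-≤ (δ (react t (coin ω v t) (s₁ t ω) (s₂ t ω) (s₃ t ω)) blank) ≤1)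
      (≤-reflexive (*-identityʳ _))
  ... | red   | ≤0 rewrite n≤0⇒n≡0 ≤0 =
      ≤-trans (≤-reflexive (*-zeroʳ (δ (react t (coin ω v t) (s₁ t ω) (s₂ t ω) (s₃ t ω)) blank))) z≤n
  ... | blue  | ≤0 rewrite n≤0⇒n≡0 ≤0 =
      ≤-trans (≤-reflexive (*-zeroʳ (δ (react t (coin ω v t) (s₁ t ω) (s₂ t ω) (s₃ t ω)) blank))) z≤n

  kernel : ℕ → Status → Status → ℕ
  kernel t = transition D (r t)

  -- `r t s / D` stands for the unconditional probability that the only change happens in round `t`
  -- and leads to colour `s`. All steps without a change therefore get the neutral factor `D`, and
  -- losing or changing a colour gets 0.
  weight : ∀ t → History t → ℕ
  weight zero    []      = 1
  weight (suc t) (s ∷ x) = kernel t (last x) s * weight t x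

  Law : ∀ t → Trajectory → (Status → ℕ) → Set
  Law t s υ = ∀ x → follows t s x ≽ weight t x * υ (last x) / (D ^ suc t)

  Σ-weights : ∀ t → (Status → Status → Status → ℕ) → ℕ
  Σ-weights t F = ∑ʰ t λ x y z →
    weight t x * (weight t y * weight t z) * (survival t x y z * F (last x) (last y) (last z))

  -- The last step depends only on the final two statuses of each history, so it can be absorbed
  -- into `F`. The sum over exponentially many triples thus reduces to `t` linear maps on functions
  -- of three statuses.
  Σ-weights-suc : ∀ t F → Σ-weights (suc t) F ≡ Σ-weights t λ a b c → κ t a b c *
    Σ³ λ a′ b′ c′ → kernel t a a′ * (kernel t b b′ * kernel t c c′) * F a′ b′ c′
  Σ-weights-suc t F = ∑ʰ-cong t λ x y z → trans
    (Σ³-cong λ a b c → solve 9 (λ ka kb kc wx wy wz κ s F →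
        (ka :* wx) :* ((kb :* wy) :* (kc :* wz)) :* ((κ :* s) :* F) := (wx :* (wy :* wz)) :* (s :* κ) :* (ka :* (kb :* kc) :* F))
      refl (kernel t (last x) a) (kernel t (last y) b) (kernel t (last z) c) (weight t x) (weight t y) (weight t z)
      (κ t (last x) (last y) (last z)) (survival t x y z) (F a b c))
    (trans (Σ³-* (weight t x * (weight t y * weight t z) * (survival t x y z * κ t (last x) (last y) (last z)))
                 (λ a b c → kernel t (last x) a * (kernel t (last y) b * kernel t (last z) c) * F a b c))
    (trans (*-assoc (weight t x * (weight t y * weight t z)) _ _)
      (cong (weight t x * (weight t y * weight t z) *_) (*-assoc (survival t x y z) _ _))))

  within-follows : ∀ t {s : Trajectory} {b} → (∀ i → i ≤ t → Within (s i) b) → ∀ x → Within (follows t s x) b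
  within-follows zero    sb []      w∉ i ω c = refl
  within-follows (suc t) sb (a ∷ x) w∉ i ω c =
    cong₂ (λ s m → δ s a * m) (sb (suc t) ≤-refl w∉ i ω c) (within-follows t (λ i i≤t → sb i (m≤n⇒m≤1+n i≤t)) x w∉ i ω c)

  module _
    {t : ℕ} (t<T : t < T) (v : Fin n) {s₁ s₂ s₃ : Trajectory} {b₁ b₂ b₃ : List (Fin n)}
    (s₁₀ : ∀ ω → s₁ 0 ω ≡ blank) (s₂₀ : ∀ ω → s₂ 0 ω ≡ blank) (s₃₀ : ∀ ω → s₃ 0 ω ≡ blank)
    (within₁ : ∀ i → i ≤ t → Within (s₁ i) b₁) (within₂ : ∀ i → i ≤ t → Within (s₂ i) b₂)
    (within₃ : ∀ i → i ≤ t → Within (s₃ i) b₃)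
    (b₁#b₂ : Disjoint b₁ b₂) (b₁#b₃ : Disjoint b₁ b₃) (b₂#b₃ : Disjoint b₂ b₃)
    (b₁#v : Disjoint b₁ (v ∷ [])) (b₂#v : Disjoint b₂ (v ∷ [])) (b₃#v : Disjoint b₃ (v ∷ []))
    {υ₁ υ₂ υ₃ : Status → ℕ} (law₁ : Law t s₁ υ₁) (law₂ : Law t s₂ υ₂) (law₃ : Law t s₃ υ₃)
    (K : C → Status → Status → Status → ℕ)
    {s : Trajectory} (s₀ : ∀ ω → s 0 ω ≡ blank)
    (step : ∀ ω i → s i ω ≡ blank → s (suc i) ω ≡ react i (coin ω v i) (s₁ i ω) (s₂ i ω) (s₃ i ω))
    where

    -- Split by the histories of the three neighbours. For fixed histories the factors are the three
    -- events of following them, the coin of round `t` and the earlier coins of `v`; they read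
    -- disjoint sets of coins, so their lower bounds multiply.
    estimate : (λ ω → K (coin ω v t) (s₁ t ω) (s₂ t ω) (s₃ t ω) * δ (s t ω) blank) ≽
               Σ-weights t (λ a b c → υ₁ a * (υ₂ b * (υ₃ c * ∑ L λ k → K k a b c))) /
               (D ^ suc t * (D ^ suc t * (D ^ suc t * (q * q ^ t))))
    estimate = ≽-mono pointwise (≽-∑ʰ t term)
      where
      event : History t → History t → History t → Ω → ℕ
      event x y z ω = K (coin ω v t) (last x) (last y) (last z) * alive t v x y z ω

      pointwise : ∀ ω → (∑ʰ t λ x y z → follows t s₁ x ω * (follows t s₂ y ω * (follows t s₃ z ω * event x y z ω))) ≤
                  K (coin ω v t) (s₁ t ω) (s₂ t ω) (s₃ t ω) * δ (s t ω) blank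
      pointwise ω
        rewrite ∑ʰ-follows t s₁ s₂ s₃ ω (λ x y z → event x y z ω)
              | last-history t s₁ (s₁₀ ω) | last-history t s₂ (s₂₀ ω) | last-history t s₃ (s₃₀ ω)
        = *-monoʳ-≤ (K (coin ω v t) (s₁ t ω) (s₂ t ω) (s₃ t ω))
            (alive-≤ t v {s₁} {s₂} {s₃} {ω} (s₁₀ ω) (s₂₀ ω) (s₃₀ ω) {λ i → s i ω} (s₀ ω) (step ω))

      term : ∀ x y z → (λ ω → follows t s₁ x ω * (follows t s₂ y ω * (follows t s₃ z ω * event x y z ω))) ≽
             weight t x * (weight t y * weight t z) *
               (survival t x y z * (υ₁ (last x) * (υ₂ (last y) * (υ₃ (last z) * ∑ L λ k → K k (last x) (last y) (last z))))) /
             (D ^ suc t * (D ^ suc t * (D ^ suc t * (q * q ^ t))))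
      term x y z = ≽-weaken (≤-reflexive (solve 8 (λ wx wy wz s u1 u2 u3 k →
            wx :* (wy :* wz) :* (s :* (u1 :* (u2 :* (u3 :* k)))) := (wx :* u1) :* ((wy :* u2) :* ((wz :* u3) :* (k :* s))))
          refl (weight t x) (weight t y) (weight t z) (survival t x y z)
               (υ₁ (last x)) (υ₂ (last y)) (υ₃ (last z)) (∑ L λ k → K k (last x) (last y) (last z))))
        (≽-* (within-independent f₁ (within-* f₂ (within-* f₃ fe)) (disjoint-++ b₂ b₁#b₂ (disjoint-++ b₃ b₁#b₃ b₁#v))) (law₁ x)
        (≽-* (within-independent f₂ (within-* f₃ fe) (disjoint-++ b₃ b₂#b₃ b₂#v)) (law₂ y)
        (≽-* (within-independent f₃ fe b₃#v) (law₃ z)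
        (≽-* (coin-alive-independent (λ k → K k (last x) (last y) (last z)) v x y z t<T)
             (≽-coordinate (λ k → K k (last x) (last y) (last z)) (coord v t))
             (alive-≽ v x y z (<⇒≤ t<T))))))
        where
        f₁ : Within (follows t s₁ x) b₁
        f₁ = within-follows t within₁ x
        f₂ : Within (follows t s₂ y) b₂
        f₂ = within-follows t within₂ y
        f₃ : Within (follows t s₃ z) b₃
        f₃ = within-follows t within₃ z
        fe : Within (event x y z) (v ∷ [])
        fe w∉ i ω c = cong₂ _*_ (cong (λ k → K k (last x) (last y) (last z)) (within-coin v t w∉ i ω c))
                    (within-alive t v x y z w∉ i ω c)

-- Pointwise inequalities for the ends of an edge

δ-decide : ∀ s s′ → δ (decide s s′) blank ≤ δ (decide s s′) blank * δ s blank
δ-decide blank s′ = ≤-reflexive (sym (*-identityʳ _))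
δ-decide red   s′ = z≤n
δ-decide blue  s′ = z≤n

δ-idem : ∀ s a → δ s a ≡ δ s a * δ s a
δ-idem blank blank = refl
δ-idem blank red   = refl
δ-idem blank blue  = refl
δ-idem red   blank = refl
δ-idem red   red   = refl
δ-idem red   blue  = refl
δ-idem blue  blank = refl
δ-idem blue  red   = refl
δ-idem blue  blue  = refl

opp-sym : ∀ a b → opp a b ≡ opp b a
opp-sym blank blank = refl
opp-sym blank red   = refl
opp-sym blank blue  = refl
opp-sym red   blank = refl
opp-sym red   red   = refl
opp-sym red   blue  = refl
opp-sym blue  blank = refl
opp-sym blue  red   = refl
opp-sym blue  blue  = refl

-- There are four exclusive ways to end a round with opposite colours: the ends had them before,
-- either end answers the colour of the other, or both are coloured in this round.
opp-decide : ∀ a b a′ b′ → opp a b + (δ b blank * opp a (decide b b′) + δ a blank * opp b (decide a a′) +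
             δ a blank * (δ b blank * opp (decide a a′) (decide b b′))) ≤ opp (decide a a′) (decide b b′)
opp-decide blank blank a′ b′ = ≤-reflexive (trans (*-identityˡ _) (*-identityˡ _))
opp-decide blank red   a′ b′ = ≤-reflexive (trans (+-identityʳ _) (trans (*-identityˡ _) (opp-sym red a′)))
opp-decide blank blue  a′ b′ = ≤-reflexive (trans (+-identityʳ _) (trans (*-identityˡ _) (opp-sym blue a′)))
opp-decide red   blank a′ b′ = ≤-reflexive (trans (+-identityʳ _) (trans (+-identityʳ _) (*-identityˡ _)))
opp-decide blue  blank a′ b′ = ≤-reflexive (trans (+-identityʳ _) (trans (+-identityʳ _) (*-identityˡ _)))
opp-decide red   red   a′ b′ = ≤-refl
opp-decide red   blue  a′ b′ = ≤-refl
opp-decide blue  red   a′ b′ = ≤-refl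
opp-decide blue  blue  a′ b′ = ≤-refl

-- Meant for messages `a`, `b` and statuses `x`, `y`, with primes for the next round. It replaces an
-- event about statuses by one about the two messages of an edge, which are independent.
both-blank : ∀ a b a′ b′ {x y x′ y′} → (a ≡ blank → b ≡ blank → x ≡ blank × y ≡ blank × x′ ≡ a′ × y′ ≡ b′) →
             δ a blank * δ a′ red * (δ b blank * δ b′ blue) + δ a blank * δ a′ blue * (δ b blank * δ b′ red) ≤
             δ x blank * (δ y blank * opp x′ y′)
both-blank red   b     a′ b′ _ = z≤n
both-blank blue  b     a′ b′ _ = z≤n
both-blank blank red   a′ b′ _ = ≤-trans (≤-reflexive (cong₂ _+_ (*-zeroʳ (1 * δ a′ red)) (*-zeroʳ (1 * δ a′ blue)))) z≤n
both-blank blank blue  a′ b′ _ = ≤-trans (≤-reflexive (cong₂ _+_ (*-zeroʳ (1 * δ a′ red)) (*-zeroʳ (1 * δ a′ blue)))) z≤n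
both-blank blank blank a′ b′ h with refl , refl , refl , refl ← h refl refl = values a′ b′
  where
  values : ∀ a′ b′ → 1 * δ a′ red * (1 * δ b′ blue) + 1 * δ a′ blue * (1 * δ b′ red) ≤ 1 * (1 * opp a′ b′)
  values blank b     = z≤n
  values red   blank = z≤n
  values red   red   = z≤n
  values red   blue  = s≤s z≤n
  values blue  blank = z≤n
  values blue  red   = s≤s z≤n
  values blue  blue  = z≤n

on-blank : ∀ s {p p′} → (s ≡ blank → p ≡ p′) → p * δ s blank ≤ δ s blank * p′
on-blank blank {p} p≡ = ≤-reflexive (trans (*-comm p 1) (cong (1 *_) (p≡ refl)))
on-blank red   {p} _  = ≤-reflexive (*-zeroʳ p)
on-blank blue  {p} _  = ≤-reflexive (*-zeroʳ p)

-- Bounds for messages and edges from a tensor of weights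

module Bounds
  {C : Set} (c₀ : C) (L : List (ℕ × C)) .{{q≢0 : NonZero (total L)}}
  (act : ℕ → C → ℕ → ℕ → Status)
  (T : ℕ) .{{T≢0 : NonZero T}}
  (D : ℕ) .{{D≢0 : NonZero D}} (r : ℕ → Status → ℕ)
  {n : ℕ} (G : Graph n) (cubic : Cubic G)
  (girth : ∀ C → 2 + (T + T) ≤ cycleLength G C)
  where

  open Graph G using (Adj) renaming (sym to adj-sym)
  open Process c₀ L act T G cubic
  open Estimate c₀ L act T D r G cubic
  open Locality G T girth

  -- A history that ends blank has weight 0 unless it is blank throughout, and then its weight is
  -- `D ^ t`. A trajectory that never loses a colour and is blank at time `t` follows this history.
  weight-blank : ∀ t {s : Trajectory} {ω} → (∀ i → ∃ λ a → s (suc i) ω ≡ decide (s i ω) a) → ∀ x → last x ≡ blank →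
                 weight t x * δ (s t ω) blank ≤ D ^ t * follows t s x ω
  weight-blank zero    {s} {ω} persists [] _ with s 0 ω
  ... | blank = ≤-refl
  ... | red   = z≤n
  ... | blue  = z≤n
  weight-blank (suc t) {s} {ω} persists (blank ∷ x) refl with last x in eq
  ... | red   = z≤n
  ... | blue  = z≤n
  ... | blank with a , s≡ ← persists t = begin
    D * weight t x * δ (s (suc t) ω) blank
      ≤⟨ *-monoʳ-≤ (D * weight t x) (subst (λ s′ → δ s′ blank ≤ δ s′ blank * δ (s t ω) blank) (sym s≡) (δ-decide (s t ω) a)) ⟩
    D * weight t x * (δ (s (suc t) ω) blank * δ (s t ω) blank)
      ≡⟨ solve 4 (λ d w x y → d :* w :* (x :* y) := d :* x :* (w :* y)) refl D (weight t x) (δ (s (suc t) ω) blank) (δ (s t ω) blank) ⟩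
    D * δ (s (suc t) ω) blank * (weight t x * δ (s t ω) blank)
      ≤⟨ *-monoʳ-≤ (D * δ (s (suc t) ω) blank) (weight-blank t persists x eq) ⟩
    D * δ (s (suc t) ω) blank * (D ^ t * follows t s x ω)
      ≡⟨ solve 4 (λ d w x y → d :* w :* (x :* y) := d :* x :* (w :* y)) refl D (δ (s (suc t) ω) blank) (D ^ t) (follows t s x ω) ⟩
    D * D ^ t * (δ (s (suc t) ω) blank * follows t s x ω) ∎
    where open ≤-Reasoning

  follows-last : ∀ t (s : Trajectory) {ω} → s 0 ω ≡ blank → ∀ x → follows t s x ω ≡ δ (s t ω) (last x) * follows t s x ω
  follows-last zero    s s₀ []      rewrite s₀ = refl
  follows-last (suc t) s {ω} s₀ (a ∷ x) = trans (cong (_* follows t s x ω) (δ-idem (s (suc t) ω) a))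
      (*-assoc (δ (s (suc t) ω) a) (δ (s (suc t) ω) a) _)

  frozen : Status → ℕ
  frozen = blank-mass D

  -- Lets the vertex that is kept blank act as a third neighbour: `frozen` singles out the all-blank
  -- history, so that messages are computed from the same tensor as statuses.
  frozen-law : ∀ t → Law t (λ _ _ → blank) frozen
  frozen-law t x with last x in eq
  ... | red   = ≽-weaken (≤-reflexive (*-zeroʳ (weight t x))) ≽-zero
  ... | blue  = ≽-weaken (≤-reflexive (*-zeroʳ (weight t x))) ≽-zero
  ... | blank = subst₂ (λ p d → follows t (λ _ _ → blank) x ≽ p / d)
      (solve 2 (λ d w → d :* (w :* con 1) := w :* d) refl D (weight t x))
      (cong (D *_) (*-identityʳ (D ^ t)))
      (≽-scale D (≽-mono-scaled {f = λ _ → 1} (weight t x) (D ^ t)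
        (λ ω → weight-blank t {λ _ _ → blank} {ω} (λ _ → blank , refl) x eq) (≽-const {d = 1} 1)))

  -- `W t a b c / D` is to be a lower bound for the normalised weight of all triples of histories
  -- ending in `a`, `b`, `c`, including the chance that the centre stays blank; `ν t / D` is one for
  -- the probability of a blank message.
  module Table
    (W : ℕ → Status → Status → Status → ℕ) (ν : ℕ → ℕ)
    where

    free : ℕ → Status → ℕ
    free t = mass D (ν t)

    pair : ℕ → (ℕ → Status → ℕ) → (C → Status → Status → Status → ℕ) → ℕ
    pair t υ K = Σ³ λ a b c → W t a b c * (free t a * (free t b * (υ t c * ∑ L λ k → K k a b c)))

    module _
      (W-zero : ∀ (F : Status → Status → Status → ℕ) → Σ³ (λ a b c → W 0 a b c * F a b c) ≤ D * F blank blank blank)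
      (W-suc : ∀ t a′ b′ c′ → q * (D * (D * D)) * W (suc t) a′ b′ c′ ≤
               Σ³ λ a b c → W t a b c * κ t a b c * (kernel t a a′ * (kernel t b b′ * kernel t c c′)))
      (r-bound : ∀ t s → q * (D * (D * D)) * r t s ≤ pair t (λ _ → frozen) λ k a b c → δ (react t k a b c) s)
      (ν-zero : ν 0 ≤ D) (ν-suc : ∀ t → ν (suc t) ≡ r t blank)
      where

      -- Proved for all `F` at once, because the inductive step applies the bound at time `t` to the
      -- function into which `Σ-weights-suc` turns `F`.
      tensor-bound : ∀ t F → D ^ t * (D ^ t * D ^ t) * q ^ t * Σ³ (λ a b c → W t a b c * F a b c) ≤ D * Σ-weights t F
      tensor-bound zero    F = subst₂ _≤_ (sym (*-identityˡ _)) (cong (D *_) (sym (trans (*-identityˡ _) (*-identityˡ _)))) (W-zero F)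
      tensor-bound (suc t) F = begin
        D * D ^ t * (D * D ^ t * (D * D ^ t)) * (q * q ^ t) * Σ³ (λ a b c → W (suc t) a b c * F a b c)
          ≡⟨ solve 5 (λ d dt q qt x → d :* dt :* (d :* dt :* (d :* dt)) :* (q :* qt) :* x :=
                        dt :* (dt :* dt) :* qt :* (q :* (d :* (d :* d)) :* x)) refl D (D ^ t) q (q ^ t) _ ⟩
        scale * (q * (D * (D * D)) * Σ³ (λ a b c → W (suc t) a b c * F a b c))
          ≡⟨ cong (scale *_) (Σ³-* (q * (D * (D * D))) _) ⟨
        scale * Σ³ (λ a b c → q * (D * (D * D)) * (W (suc t) a b c * F a b c))
          ≡⟨ cong (scale *_) (Σ³-cong λ a b c → sym (*-assoc (q * (D * (D * D))) (W (suc t) a b c) (F a b c))) ⟩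
        scale * Σ³ (λ a b c → q * (D * (D * D)) * W (suc t) a b c * F a b c)
          ≤⟨ *-monoʳ-≤ scale (Σ³-mono λ a′ b′ c′ → *-monoˡ-≤ (F a′ b′ c′) (W-suc t a′ b′ c′)) ⟩
        scale * Σ³ (λ a′ b′ c′ → Σ³ (λ a b c → W t a b c * κ t a b c * kkk a b c a′ b′ c′) * F a′ b′ c′)
          ≡⟨ cong (scale *_) (Σ³-cong λ a′ b′ c′ → trans (*-comm _ (F a′ b′ c′)) (sym (Σ³-* (F a′ b′ c′) _))) ⟩
        scale * Σ³ (λ a′ b′ c′ → Σ³ λ a b c → F a′ b′ c′ * (W t a b c * κ t a b c * kkk a b c a′ b′ c′))
          ≡⟨ cong (scale *_) (Σ³-swap λ a b c a′ b′ c′ → F a′ b′ c′ * (W t a b c * κ t a b c * kkk a b c a′ b′ c′)) ⟨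
        scale * Σ³ (λ a b c → Σ³ λ a′ b′ c′ → F a′ b′ c′ * (W t a b c * κ t a b c * kkk a b c a′ b′ c′))
          ≡⟨ cong (scale *_) (Σ³-cong λ a b c → trans
               (Σ³-cong λ a′ b′ c′ → solve 3 (λ f w k → f :* (w :* k) := w :* (k :* f))
                  refl (F a′ b′ c′) (W t a b c * κ t a b c) (kkk a b c a′ b′ c′))
               (trans (Σ³-* (W t a b c * κ t a b c) _) (*-assoc (W t a b c) (κ t a b c) _))) ⟩
        scale * Σ³ (λ a b c → W t a b c * (κ t a b c * Σ³ λ a′ b′ c′ → kkk a b c a′ b′ c′ * F a′ b′ c′))
          ≤⟨ tensor-bound t _ ⟩
        D * Σ-weights t (λ a b c → κ t a b c * Σ³ λ a′ b′ c′ → kkk a b c a′ b′ c′ * F a′ b′ c′)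
          ≡⟨ cong (D *_) (Σ-weights-suc t F) ⟨
        D * Σ-weights (suc t) F ∎
        where
        open ≤-Reasoning
        scale = D ^ t * (D ^ t * D ^ t) * q ^ t
        kkk : (a b c a′ b′ c′ : Status) → ℕ
        kkk a b c a′ b′ c′ = kernel t a a′ * (kernel t b b′ * kernel t c c′)

      table-bound : ∀ t F {f : Ω → ℕ} → f ≽ Σ-weights t F / (D ^ suc t * (D ^ suc t * (D ^ suc t * (q * q ^ t)))) →
                    f ≽ Σ³ (λ a b c → W t a b c * F a b c) / (q * (D * (D * D)) * D)
      table-bound t F {f} f≽ = ≽-cancel scale {{scale≢0}} (subst (λ d → f ≽ scale * Σ³ (λ a b c → W t a b c * F a b c) / d)
          (solve 4 (λ d dt q qt → d :* (d :* dt :* (d :* dt :* (d :* dt :* (q :* qt))))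
              := dt :* (dt :* dt) :* qt :* (q :* (d :* (d :* d)) :* d))
             refl D (D ^ t) q (q ^ t))
          (≽-weaken (tensor-bound t F) (≽-scale D f≽)))
        where
        scale = D ^ t * (D ^ t * D ^ t) * q ^ t
        scale≢0 : NonZero scale
        scale≢0 = m*n≢0 (D ^ t * (D ^ t * D ^ t)) (q ^ t)
          {{m*n≢0 (D ^ t) (D ^ t * D ^ t) {{m^n≢0 D t}} {{m*n≢0 (D ^ t) (D ^ t) {{m^n≢0 D t}} {{m^n≢0 D t}}}}}} {{m^n≢0 q t}}

      branch-within : ∀ {t} u v i → i ≤ t → Within (message i u v) (branch G t u v)
      branch-within u v i i≤t = within-⊆ (branch-mono-≤ G i≤t) (within-message i u v)

      centre-disjoint : ∀ {t u v} → t ≤ T → Adj v u → Disjoint (branch G t u v) (v ∷ [])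
      centre-disjoint t≤T vu w∈ (here refl) = centre∉branch t≤T vu w∈

      LawAt : ℕ → Set
      LawAt t = ∀ {u v} → Adj u v → Law t (λ i → message i u v) (free t)

      -- Forms one induction with `law`: the laws at time `t` bound the changes in round `t`, and
      -- these give the laws at time `suc t`.
      message-bound : ∀ t → t < T → LawAt t → ∀ {u v} → Adj u v → ∀ s →
                      (λ ω → δ (message t u v ω) blank * δ (message (suc t) u v ω) s) ≽ r t s / D
      message-bound t t<T law {u} {v} uv s = ≽-cancel (q * (D * (D * D)))
        {{m*n≢0 q (D * (D * D)) {{q≢0}} {{m*n≢0 D (D * D) {{D≢0}} {{m*n≢0 D D}}}}}}
        (≽-weaken (r-bound t s) (table-bound t _ (≽-mono pointwise
          (estimate t<T u {λ i → message i c₁ u} {λ i → message i c₂ u} {λ _ _ → blank} {branch G t c₁ u} {branch G t c₂ u} {[]}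
            (λ _ → refl) (λ _ → refl) (λ _ → refl)
            (branch-within c₁ u) (branch-within c₂ u) (λ _ _ _ _ _ _ → refl)
            (siblings-disjoint (<⇒≤ t<T) adj₁ adj₂ c₁≢c₂) (λ _ ()) (λ _ ())
            (centre-disjoint (<⇒≤ t<T) adj₁) (centre-disjoint (<⇒≤ t<T) adj₂) (λ ())
            {free t} {free t} {frozen}
            (law (adj-sym adj₁)) (law (adj-sym adj₂)) (frozen-law t)
            K {λ i → message i u v} (λ _ → refl) step))))
        where
        open Others (two-others G cubic uv)
        K : C → Status → Status → Status → ℕ
        K k a b c = δ (react t k a b c) s

        step : ∀ ω i → message i u v ω ≡ blank →
               message (suc i) u v ω ≡ react i (coin ω u i) (message i c₁ u ω) (message i c₂ u ω) blank
        step ω i m≡ = trans (message-step uv i ω)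
          (cong (λ m → decide m (react i (coin ω u i) (message i c₁ u ω) (message i c₂ u ω) blank)) m≡)

        pointwise : ∀ ω → K (coin ω u t) (message t c₁ u ω) (message t c₂ u ω) blank * δ (message t u v ω) blank ≤
                          δ (message t u v ω) blank * δ (message (suc t) u v ω) s
        pointwise ω = on-blank (message t u v ω) λ m≡ → cong (λ m → δ m s) (sym (step ω t m≡))

      law : ∀ t → t ≤ T → LawAt t
      law zero    _   uv [] = subst (λ d → _≽_/_ {n * T} (λ _ → 1) (1 * ν 0) d) (sym (*-identityʳ D))
        (≽-weaken (subst₂ _≤_ (sym (*-identityˡ (ν 0))) (sym (*-identityʳ D)) ν-zero) (≽-const {d = D} 1))
      law (suc t) t<T {u} {v} uv (s ∷ x) = cases (last x) s refl
        where
        m : Trajectory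
        m i = message i u v

        persists : ∀ ω i → ∃ λ a → m (suc i) ω ≡ decide (m i ω) a
        persists ω i = _ , refl

        Goal : Status → Status → Set
        Goal a s = (λ ω → δ (m (suc t) ω) s * follows t m x ω) ≽ kernel t a s * weight t x * free (suc t) s / (D * (D * D ^ t))


        -- A coloured message keeps its colour, so the longer history is followed whenever `x` is.
        stays : ∀ c {p} → last x ≡ c → free t c ≡ D → (∀ a → δ (decide c a) c ≡ 1) → p ≡ D * weight t x * D →
                (λ ω → δ (m (suc t) ω) c * follows t m x ω) ≽ p / (D * (D * D ^ t))
        stays c refl free≡ fixed refl = ≽-weaken
          (≤-reflexive (trans (*-assoc D (weight t x) D) (cong (λ υ → D * (weight t x * υ)) (sym free≡))))
          (≽-scale D (≽-mono pointwise (law t (<⇒≤ t<T) uv x)))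
          where
          pointwise : ∀ ω → follows t m x ω ≤ δ (m (suc t) ω) c * follows t m x ω
          pointwise ω = begin
            follows t m x ω                        ≡⟨ follows-last t m refl x ⟩
            δ (m t ω) (last x) * follows t m x ω   ≤⟨ *-monoˡ-≤ (follows t m x ω) (still (m t ω) refl) ⟩
            δ (m (suc t) ω) c * follows t m x ω    ∎
            where
            open ≤-Reasoning
            still : ∀ s → m t ω ≡ s → δ s (last x) ≤ δ (m (suc t) ω) (last x)
            still s eq with a , m≡ ← persists ω t rewrite m≡ | eq = keep s (last x) a (fixed a)
              where
              keep : ∀ s c a → δ (decide c a) c ≡ 1 → δ s c ≤ δ (decide s a) c
              keep blank blank a f≡ = ≤-reflexive (sym f≡)
              keep blank red   a f≡ = z≤n
              keep blank blue  a f≡ = z≤n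
              keep red   c     a f≡ = ≤-refl
              keep blue  c     a f≡ = ≤-refl

        -- By `weight-blank`, only the event of being blank at time `t` matters, and `message-bound`
        -- treats it jointly with the next status.
        leaves : last x ≡ blank → ∀ s {p} → p ≡ D * (weight t x * r t s) →
                 (λ ω → δ (m (suc t) ω) s * follows t m x ω) ≽ p / (D * (D * D ^ t))
        leaves x○ s refl = subst (λ d → (λ ω → δ (m (suc t) ω) s * follows t m x ω) ≽ D * (weight t x * r t s) / (D * d))
          (*-comm (D ^ t) D)
          (≽-scale D (≽-mono-scaled (weight t x) (D ^ t) pointwise (message-bound t t<T (law t (<⇒≤ t<T)) uv s)))
          where
          pointwise : ∀ ω → weight t x * (δ (m t ω) blank * δ (m (suc t) ω) s) ≤ D ^ t * (δ (m (suc t) ω) s * follows t m x ω)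
          pointwise ω = begin
            weight t x * (δ (m t ω) blank * δ (m (suc t) ω) s)   ≡⟨ *-assoc (weight t x) _ _ ⟨
            weight t x * δ (m t ω) blank * δ (m (suc t) ω) s
              ≤⟨ *-monoˡ-≤ (δ (m (suc t) ω) s) (weight-blank t {m} {ω} (persists ω) x x○) ⟩
            D ^ t * follows t m x ω * δ (m (suc t) ω) s
              ≡⟨ trans (*-assoc (D ^ t) _ _) (cong (D ^ t *_) (*-comm _ (δ (m (suc t) ω) s))) ⟩
            D ^ t * (δ (m (suc t) ω) s * follows t m x ω)        ∎
            where open ≤-Reasoning

        cases : ∀ a s → last x ≡ a → Goal a s
        -- The factors for staying blank are neutral, so `ν (suc t)` alone carries the probability
        -- of having stayed blank through all rounds.
        cases blank blank x○ = leaves x○ blank (trans (*-assoc D (weight t x) _) (cong (λ υ → D * (weight t x * υ)) (ν-suc t)))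
        cases blank red   x○ = leaves x○ red  (solve 3 (λ d w r → r :* w :* d := d :* (w :* r)) refl D (weight t x) (r t red))
        cases blank blue  x○ = leaves x○ blue (solve 3 (λ d w r → r :* w :* d := d :* (w :* r)) refl D (weight t x) (r t blue))
        cases red   red   xc = stays red  xc refl (λ _ → refl) refl
        cases blue  blue  xc = stays blue xc refl (λ _ → refl) refl
        cases red   blank _  = ≽-zero
        cases red   blue  _  = ≽-zero
        cases blue  blank _  = ≽-zero
        cases blue  red   _  = ≽-zero

      scale : ℕ
      scale = q * (D * (D * D)) * D

      later : ℕ → C → Status → Status → Status → ℕ
      later t k a b c = opp c (react t k a b c)

      -- As long as `v` is blank, `u` has the status of its message to `v`. The estimate for three
      -- messages into `v` therefore also tells which colour of `u` is answered.
      later-bound : ∀ t → t < T → ∀ {u v} → Adj v u →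
        (λ ω → δ (status t v ω) blank * opp (status t u ω) (status (suc t) v ω)) ≽ pair t free (later t) / scale
      later-bound t t<T {u} {v} vu = table-bound t _ (≽-mono pointwise
        (estimate t<T v {λ i → message i c₁ v} {λ i → message i c₂ v} {λ i → message i u v}
          {branch G t c₁ v} {branch G t c₂ v} {branch G t u v}
          (λ _ → refl) (λ _ → refl) (λ _ → refl)
          (branch-within c₁ v) (branch-within c₂ v) (branch-within u v)
          (siblings-disjoint (<⇒≤ t<T) adj₁ adj₂ c₁≢c₂) (siblings-disjoint (<⇒≤ t<T) adj₁ vu c₁≢v)
          (siblings-disjoint (<⇒≤ t<T) adj₂ vu c₂≢v)
          (centre-disjoint (<⇒≤ t<T) adj₁) (centre-disjoint (<⇒≤ t<T) adj₂) (centre-disjoint (<⇒≤ t<T) vu)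
          {free t} {free t} {free t}
          (law t (<⇒≤ t<T) (adj-sym adj₁)) (law t (<⇒≤ t<T) (adj-sym adj₂)) (law t (<⇒≤ t<T) (adj-sym vu))
          (later t) {λ i → status i v} (λ _ → refl) step))
        where
        open Others (two-others G cubic vu)

        step : ∀ ω i → status i v ω ≡ blank →
               status (suc i) v ω ≡ react i (coin ω v i) (message i c₁ v ω) (message i c₂ v ω) (message i u v ω)
        step ω i v○ = trans (status-step vu i ω) (cong₂ decide v○ (begin
          react i (coin ω v i) (status i c₁ ω) (status i c₂ ω) (status i u ω)
            ≡⟨ cong₂ (λ a b → react i (coin ω v i) a b (status i u ω))
                 (status-message i (adj-sym adj₁) v○) (status-message i (adj-sym adj₂) v○) ⟩
          react i (coin ω v i) (message i c₁ v ω) (message i c₂ v ω) (status i u ω)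
            ≡⟨ cong (react i (coin ω v i) (message i c₁ v ω) (message i c₂ v ω)) (status-message i (adj-sym vu) v○) ⟩
          react i (coin ω v i) (message i c₁ v ω) (message i c₂ v ω) (message i u v ω) ∎))
          where open ≡-Reasoning

        pointwise : ∀ ω → later t (coin ω v t) (message t c₁ v ω) (message t c₂ v ω) (message t u v ω) * δ (status t v ω) blank ≤
                          δ (status t v ω) blank * opp (status t u ω) (status (suc t) v ω)
        pointwise ω = on-blank (status t v ω) λ v○ → sym (cong₂ opp (status-message t (adj-sym vu) v○) (step ω t v○))

      -- From two blank ends, each is coloured as its message to the other, and the two messages
      -- read disjoint branches.
      together-bound : ∀ t → t < T → ∀ {u v} → Adj u v →
        (λ ω → δ (status t u ω) blank * (δ (status t v ω) blank * opp (status (suc t) u ω) (status (suc t) v ω))) ≽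
        r t red * r t blue + r t blue * r t red / (D * D)
      together-bound t t<T {u} {v} uv = ≽-mono pointwise (≽-+ (colours red blue) (colours blue red))
        where
        colours : ∀ c c′ → (λ ω → δ (message t u v ω) blank * δ (message (suc t) u v ω) c *
                                   (δ (message t v u ω) blank * δ (message (suc t) v u ω) c′)) ≽
                           r t c * r t c′ / (D * D)
        colours c c′ = ≽-* (within-independent (within-event u v c) (within-event v u c′) (opposite-disjoint t<T uv))
            (message-bound t t<T (law t (<⇒≤ t<T)) uv c) (message-bound t t<T (law t (<⇒≤ t<T)) (adj-sym uv) c′)
          where
          within-event : ∀ u v c → Within (λ ω → δ (message t u v ω) blank * δ (message (suc t) u v ω) c) (branch G (suc t) u v)
          within-event u v c w∉ i ω k = cong₂ (λ m m′ → δ m blank * δ m′ c)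
            (branch-within {suc t} u v t (n≤1+n t) w∉ i ω k) (branch-within u v (suc t) ≤-refl w∉ i ω k)

        pointwise : ∀ ω → _ ≤ δ (status t u ω) blank * (δ (status t v ω) blank * opp (status (suc t) u ω) (status (suc t) v ω))
        pointwise ω = both-blank (message t u v ω) (message t v u ω) (message (suc t) u v ω) (message (suc t) v u ω) λ u○ v○ →
          let u○′ , v○′ = messages-blank t uv u○ v○ in
          u○′ , v○′ , status-message-suc t uv v○′ , status-message-suc t (adj-sym uv) u○′

      crossing : ℕ → ℕ
      crossing zero    = 0
      -- The factor `q * (D * D)` brings the simultaneous case from denominator `D * D` to `scale`.
      crossing (suc t) = crossing t +
        (pair t free (later t) + pair t free (later t) + q * (D * D) * (r t red * r t blue + r t blue * r t red))

      crossing-bound : ∀ t → t ≤ T → ∀ {u v} → Adj u v → (λ ω → opp (status t u ω) (status t v ω)) ≽ crossing t / scale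
      crossing-bound zero    _   uv = ≽-zero
      crossing-bound (suc t) t<T {u} {v} uv = ≽-mono (λ ω → opp-decide (status t u ω) (status t v ω) _ _)
        (≽-+ (crossing-bound t (<⇒≤ t<T) uv)
          (≽-+ (≽-+ (later-bound t t<T (adj-sym uv)) (later-bound t t<T uv))
            (subst (λ d → (λ ω → δ (status t u ω) blank * (δ (status t v ω) blank * opp (status (suc t) u ω) (status (suc t) v ω))) ≽
                          q * (D * D) * (r t red * r t blue + r t blue * r t red) / d)
              (solve 2 (λ q d → q :* (d :* d) :* (d :* d) := q :* (d :* (d :* d)) :* d) refl q D)
              (≽-scale (q * (D * D)) (together-bound t t<T uv)))))

-- Cuts from colourings

module _ {A : Set} {P : Pred A 0ℓ} (P? : Decidable P) (f : A → ℕ) (f≤1 : ∀ a → f a ≤ 1) (f⇒P : ∀ a → 0 < f a → P a) where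

  sum≤length-filter : ∀ xs → sum (map f xs) ≤ length (filter P? xs)
  sum≤length-filter []       = z≤n
  sum≤length-filter (x ∷ xs) with P? x
  ... | yes _  = +-mono-≤ (f≤1 x) (sum≤length-filter xs)
  ... | no ¬Px with f x in fx≡
  ...   | zero  = sum≤length-filter xs
  ...   | suc _ = contradiction (f⇒P x (subst (0 <_) (sym fx≡) (s≤s z≤n))) ¬Px

isRed : Status → Bool
isRed red = inside
isRed _   = outside

opp≤1 : ∀ a b → opp a b ≤ 1
opp≤1 blank b     = z≤n
opp≤1 red   blank = z≤n
opp≤1 red   red   = z≤n
opp≤1 red   blue  = ≤-refl
opp≤1 blue  blank = z≤n
opp≤1 blue  red   = ≤-refl
opp≤1 blue  blue  = z≤n

module _ {n : ℕ} (s : Fin n → Status) where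

  -- Vertices that remain blank end up on the blue side. Only edges between red and blue are
  -- counted, so the bound survives.
  reds : Subset n
  reds = tabulate λ v → isRed (s v)

  red∈ : ∀ {v} → s v ≡ red → v ∈ₛ reds
  red∈ {v} eq = lookup⇒[]= v reds (trans (lookup∘tabulate (λ v → isRed (s v)) v) (cong isRed eq))

  blue∈∁ : ∀ {v} → s v ≡ blue → v ∈ₛ ∁ reds
  blue∈∁ {v} eq = x∉p⇒x∈∁p λ v∈ → contradiction
    (trans (sym ([]=⇒lookup v∈)) (trans (lookup∘tabulate (λ v → isRed (s v)) v) (cong isRed eq))) λ ()

  opp⇒Crosses : ∀ u v → 0 < opp (s u) (s v) → Crosses reds (u , v)
  opp⇒Crosses u v 0< with s u in u≡ | s v in v≡
  ... | red  | blue = inj₁ (red∈ u≡ , blue∈∁ v≡)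
  ... | blue | red  = inj₂ (blue∈∁ u≡ , red∈ v≡)

  opp≤cut : ∀ G → sum (map (λ (u , v) → opp (s u) (s v)) (edges G)) ≤ length (cut G reds)
  opp≤cut G = sum≤length-filter (crosses? reds) (λ (u , v) → opp (s u) (s v))
    (λ (u , v) → opp≤1 (s u) (s v)) (λ (u , v) → opp⇒Crosses u v) (edges G)

girth-bound : ∀ {n g γ} {G : Graph n} → IsGirth G γ → [ g ] ≤⁺ γ → ∀ C → g ≤ cycleLength G C
girth-bound (shortest C₀ C₀≤) [ g≤ ]     C = ≤-trans g≤ (C₀≤ C)
girth-bound (acyclic ¬C)      (_ ≤⊤⁺)    C = contradiction C ¬C

module _
  {C : Set} (c₀ : C) (L : List (ℕ × C)) .{{_ : NonZero (total L)}} (act : ℕ → C → ℕ → ℕ → Status)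
  (T : ℕ) .{{_ : NonZero T}} {n : ℕ} (G : Graph n) (cubic : Cubic G)
  where

  open Process c₀ L act T G cubic

  crossings : List (Fin n × Fin n) → Ω → ℕ
  crossings es ω = sum (map (λ (u , v) → opp (status T u ω) (status T v ω)) es)

  -- First moment: by linearity, the mean number of crossing edges is at least `p / d` per edge, and
  -- some outcome is as good as the mean.
  large-cut : ∀ {p d} a b .{{_ : NonZero d}} → a * d ≤ b * p →
              (∀ {u v} → Graph.Adj G u v → (λ ω → opp (status T u ω) (status T v ω)) ≽ p / d) →
              ∃[ A ] a * length (edges G) ≤ b * length (cut G A)
  large-cut {p} {d} a b ad≤bp likely = cutAt (𝔼-attains {f = λ ω → d * crossings (edges G) ω}
      (subst (m * p * ∥ n * T ∥ ≤_) (sym (𝔼-* d (crossings (edges G))))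
        (≽-elim (expected (all-filter (isEdge? G) (cartesianProduct (allFin n) (allFin n)))))))
    where
    open ≤-Reasoning
    m = length (edges G)

    expected : ∀ {es} → All (IsEdge G) es → crossings es ≽ length es * p / d
    expected []              = ≽-zero
    expected ((_ , uv) ∷ es) = ≽-+ (likely uv) (expected es)

    cutAt : (∃ λ ω → m * p ≤ d * crossings (edges G) ω) → ∃[ A ] a * m ≤ b * length (cut G A)
    cutAt (ω , mp≤) = reds (λ v → status T v ω) , *-cancelˡ-≤ d (begin
      d * (a * m)                      ≡⟨ solve 3 (λ d a m → d :* (a :* m) := a :* d :* m) refl d a m ⟩
      a * d * m                        ≤⟨ *-monoˡ-≤ m ad≤bp ⟩
      b * p * m                        ≡⟨ solve 3 (λ b p m → b :* p :* m := b :* (m :* p)) refl b p m ⟩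
      b * (m * p)                      ≤⟨ *-monoʳ-≤ b mp≤ ⟩
      b * (d * crossings (edges G) ω)  ≡⟨ solve 3 (λ b d x → b :* (d :* x) := d :* (b :* x)) refl b d (crossings (edges G) ω) ⟩
      d * (b * crossings (edges G) ω)  ≤⟨ *-monoʳ-≤ d (*-monoʳ-≤ b (opp≤cut (λ v → status T v ω) G)) ⟩
      d * (b * length (cut G (reds λ v → status T v ω))) ∎)

-- The recursion for the expected number of crossing edges

-- Stored entries instead of functions, so that the values of a round are shared and not recomputed
-- at every lookup.
record Tri (A : Set) : Set where
  constructor tri
  field onBlank onRed onBlue : A

at : ∀ {A} → Tri A → Status → A
at (tri a b c) blank = a
at (tri a b c) red   = b
at (tri a b c) blue  = c

tab : ∀ {A : Set} → (Status → A) → Tri A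
tab f = tri (f blank) (f red) (f blue)

at-tab : ∀ {A : Set} (f : Status → A) s → at (tab f) s ≡ f s
at-tab f blank = refl
at-tab f red   = refl
at-tab f blue  = refl

Tensor : Set
Tensor = Tri (Tri (Tri ℕ))

at³ : Tensor → Status → Status → Status → ℕ
at³ W a b c = at (at (at W a) b) c

tab³ : (Status → Status → Status → ℕ) → Tensor
tab³ f = tab λ a → tab λ b → tab λ c → f a b c

at³-tab³ : ∀ f a b c → at³ (tab³ f) a b c ≡ f a b c
at³-tab³ f a b c rewrite at-tab (λ a → tab λ b → tab λ c → f a b c) a | at-tab (λ b → tab λ c → f a b c) b = at-tab (f a b) c

module Recursion
  {C : Set} (L : List (ℕ × C)) .{{q≢0 : NonZero (total L)}}
  (act : ℕ → C → ℕ → ℕ → Status)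
  (D : ℕ) .{{D≢0 : NonZero D}}
  where

  private
    q = total L

    instance
      qD³≢0 : NonZero (q * (D * (D * D)))
      qD³≢0 = m*n≢0 q (D * (D * D)) {{q≢0}} {{m*n≢0 D (D * D) {{D≢0}} {{m*n≢0 D D}}}}

  record State : Set where
    constructor state
    field
      tensor   : Tensor
      blanks   : ℕ
      crossing : ℕ
  open State

  joint : State → (Status → ℕ) → (C → Status → Status → Status → ℕ) → ℕ
  joint s υ K = Σ³ λ a b c → at³ (tensor s) a b c *
    (mass D (blanks s) a * (mass D (blanks s) b * (υ c * ∑ L λ k → K k a b c)))

  rates : ℕ → State → Tri ℕ
  rates t s = tab λ a′ → joint s (blank-mass D) (λ k a b c → δ (reaction act t k a b c) a′) / (q * (D * (D * D)))

  surviving : ℕ → State → Tensor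
  surviving t s = tab³ λ a b c → at³ (tensor s) a b c * ∑ L λ k → δ (reaction act t k a b c) blank

  -- Each neighbour moves by its own kernel. Dividing by the scale of one coin and three kernels
  -- returns the entries to scale `D`, rounded down.
  spread : Tri ℕ → Tensor → Tensor
  spread r W = tab³ λ a′ b′ c′ → (Σ³ λ a b c → at³ W a b c *
    (transition D (at r) a a′ * (transition D (at r) b b′ * transition D (at r) c c′))) / (q * (D * (D * D)))

  gain : ℕ → State → ℕ
  gain t s = joint s (mass D (blanks s)) λ k a b c → opp c (reaction act t k a b c)

  double : ℕ → ℕ
  double m = m + m

  advance : ℕ → State → Tri ℕ → State
  advance t s r = state (spread r (surviving t s)) (at r blank)
    (crossing s + (double (gain t s) + q * (D * D) * (at r red * at r blue + at r blue * at r red)))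

  next : ℕ → State → State
  next t s = advance t s (rates t s)

  run : ℕ → State
  run zero    = state (tab³ λ a b c → D * (δ blank a * (δ blank b * δ blank c))) D 0
  run (suc t) = next t (run t)

  /-bound : ∀ m → q * (D * (D * D)) * (m / (q * (D * (D * D)))) ≤ m
  /-bound m = subst (_≤ m) (*-comm _ (q * (D * (D * D)))) (m/n*n≤m m (q * (D * (D * D))))

  run-zero : ∀ (F : Status → Status → Status → ℕ) → Σ³ (λ a b c → at³ (tensor (run 0)) a b c * F a b c) ≤ D * F blank blank blank
  run-zero F = ≤-reflexive (begin
    Σ³ (λ a b c → at³ (tensor (run 0)) a b c * F a b c)
      ≡⟨ Σ³-cong (λ a b c → trans (cong (_* F a b c) (at³-tab³ (λ a b c → D * (δ blank a * (δ blank b * δ blank c))) a b c))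
           (solve 5 (λ d x y z f → d :* (x :* (y :* z)) :* f := d :* (x :* (y :* (z :* f))))
             refl D (δ blank a) (δ blank b) (δ blank c) (F a b c))) ⟩
    Σ³ (λ a b c → D * (δ blank a * (δ blank b * (δ blank c * F a b c))))
      ≡⟨ Σ³-* D (λ a b c → δ blank a * (δ blank b * (δ blank c * F a b c))) ⟩
    D * Σ³ (λ a b c → δ blank a * (δ blank b * (δ blank c * F a b c)))
      ≡⟨ cong (D *_) (Σ³-δ blank blank blank F) ⟩
    D * F blank blank blank ∎)
    where open ≡-Reasoning

  rates-bound : ∀ t s a′ → q * (D * (D * D)) * at (rates t s) a′ ≤ joint s (blank-mass D) (λ k a b c → δ (reaction act t k a b c) a′)
  rates-bound t s a′ = subst (λ m → q * (D * (D * D)) * m ≤ target)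
    (sym (at-tab (λ a′ → joint s (blank-mass D) (λ k a b c → δ (reaction act t k a b c) a′) / (q * (D * (D * D)))) a′))
    (/-bound target)
    where target = joint s (blank-mass D) (λ k a b c → δ (reaction act t k a b c) a′)

  spread-bound : ∀ t s a′ b′ c′ → q * (D * (D * D)) * at³ (tensor (next t s)) a′ b′ c′ ≤
    Σ³ λ a b c → at³ (tensor s) a b c * ∑ L (λ k → δ (reaction act t k a b c) blank) *
      (transition D (at (rates t s)) a a′ * (transition D (at (rates t s)) b b′ * transition D (at (rates t s)) c c′))
  spread-bound t s a′ b′ c′ = begin
    q * (D * (D * D)) * at³ (tensor (next t s)) a′ b′ c′
      ≡⟨ cong (q * (D * (D * D)) *_) (at³-tab³ (λ a′ b′ c′ → numerator a′ b′ c′ / (q * (D * (D * D)))) a′ b′ c′) ⟩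
    q * (D * (D * D)) * (numerator a′ b′ c′ / (q * (D * (D * D))))
      ≤⟨ /-bound (numerator a′ b′ c′) ⟩
    numerator a′ b′ c′
      ≡⟨ Σ³-cong (λ a b c → cong (_* kkk a b c a′ b′ c′)
           (at³-tab³ (λ a b c → at³ (tensor s) a b c * ∑ L (λ k → δ (reaction act t k a b c) blank)) a b c)) ⟩
    (Σ³ λ a b c → at³ (tensor s) a b c * ∑ L (λ k → δ (reaction act t k a b c) blank) * kkk a b c a′ b′ c′) ∎
    where
    open ≤-Reasoning
    kkk : (a b c a′ b′ c′ : Status) → ℕ
    kkk a b c a′ b′ c′ = transition D (at (rates t s)) a a′ * (transition D (at (rates t s)) b b′ * transition D (at (rates t s)) c c′)
    numerator : (a′ b′ c′ : Status) → ℕ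
    numerator a′ b′ c′ = Σ³ λ a b c → at³ (surviving t s) a b c * kkk a b c a′ b′ c′

  -- A record, because comparing the bare inequality with itself would unfold a
  -- product by the numeral b.
  record Sufficient (a b t : ℕ) : Set where
    constructor sufficient
    field bound : a * (q * (D * (D * D)) * D) ≤ b * crossing (run t)

  module _
    (c₀ : C) (T : ℕ) .{{_ : NonZero T}} {n : ℕ} (G : Graph n) (cubic : Cubic G)
    (girth : ∀ C → 2 + (T + T) ≤ cycleLength G C)
    where

    open Process c₀ L act T G cubic

    run-bound : ∀ {u v} → Graph.Adj G u v → (λ ω → opp (status T u ω) (status T v ω)) ≽ crossing (run T) / (q * (D * (D * D)) * D)
    run-bound {u} {v} uv = subst (λ p → (λ ω → opp (status T u ω) (status T v ω)) ≽ p / (q * (D * (D * D)) * D)) (same T)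
      (Table.crossing-bound tensors (λ t → blanks (run t)) run-zero (λ t → spread-bound t (run t)) (λ t → rates-bound t (run t))
        ≤-refl (λ _ → refl) T ≤-refl uv)
      where
      open Bounds c₀ L act T D (λ t → at (rates t (run t))) G cubic girth
      tensors : ℕ → Status → Status → Status → ℕ
      tensors t = at³ (tensor (run t))

      same : ∀ t → Table.crossing tensors (λ t → blanks (run t)) run-zero
             (λ t → spread-bound t (run t)) (λ t → rates-bound t (run t)) ≤-refl (λ _ → refl) t ≡ crossing (run t)
      same zero    = refl
      same (suc t) = cong (_+ (double (gain t (run t)) + q * (D * D) *
        (at (rates t (run t)) red * at (rates t (run t)) blue + at (rates t (run t)) blue * at (rates t (run t)) red))) (same t)

    run-cut : ∀ {a b} → Sufficient a b T → ∃[ A ] a * length (edges G) ≤ b * length (cut G A)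
    run-cut {a} {b} (sufficient large) =
      large-cut c₀ L act T G cubic {crossing (run T)} a b {{m*n≢0 (q * (D * (D * D))) D}} large run-bound

-- The bound as an inequality of rationals

open import Data.Integer using (+_)

rational-bound : ∀ c m → 8704 * m ≤ 10000 * c → + c ℚ./ 1 ℚ.≥ (+ 8704 ℚ./ 10000) ℚ.* (+ m ℚ./ 1)
rational-bound c m m≤c = ℚ.toℚᵘ-cancel-≤ (begin
  ℚ.toℚᵘ ((+ 8704 ℚ./ 10000) ℚ.* (+ m ℚ./ 1))
    ≃⟨ ℚ.toℚᵘ-homo-* (+ 8704 ℚ./ 10000) (+ m ℚ./ 1) ⟩
  ℚ.toℚᵘ (+ 8704 ℚ./ 10000) ℚᵘ.* ℚ.toℚᵘ (+ m ℚ./ 1)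
    ≃⟨ ℚᵘ.*-cong (ℚ.toℚᵘ-fromℚᵘ (mkℚᵘ (+ 8704) 9999)) (ℚ.toℚᵘ-fromℚᵘ (mkℚᵘ (+ m) 0)) ⟩
  mkℚᵘ (+ 8704) 9999 ℚᵘ.* mkℚᵘ (+ m) 0
    ≤⟨ *≤* (subst₂ ℤ._≤_ (sym (ℤ.*-identityʳ (+ 8704 ℤ.* + m))) refl
       (subst₂ ℤ._≤_ (ℤ.pos-* 8704 m) (trans (cong +_ (*-comm 10000 c)) (ℤ.pos-* c 10000)) (ℤ.+≤+ m≤c))) ⟩
  mkℚᵘ (+ c) 0
    ≃⟨ ℚ.toℚᵘ-fromℚᵘ (mkℚᵘ (+ c) 0) ⟨
  ℚ.toℚᵘ (+ c ℚ./ 1) ∎)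
  where open ℚᵘ.≤-Reasoning

-- The rule of the process and the numerical check

data Coin : Set where
  idle spark-red spark-blue go-red go-blue : Coin

-- The weights and the numbers of rounds below were found by numerical search.
coins : List (ℕ × Coin)
coins = (174 , idle) ∷ (1 , spark-red) ∷ (1 , spark-blue) ∷ (40 , go-red) ∷ (40 , go-blue) ∷ []

seed choose : Coin → Status
seed spark-red  = red
seed spark-blue = blue
seed _          = blank

choose idle       = blank
choose spark-red  = red
choose spark-blue = blue
choose go-red     = red
choose go-blue    = blue

-- A tie includes having no coloured neighbour. At time 0 only the rare sparks colour a vertex, at
-- times 1 to 24 a tied vertex waits, and from time 25 on ties are broken at random so that few
-- vertices remain blank.
tie : ℕ → Coin → Status
tie zero    k = seed k
tie (suc t) k with t <ᵇ 24
... | true  = blank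
... | false = choose k

-- The number is the surplus of the majority colour. A surplus of one lets an idle coin wait; a
-- larger one is answered whatever the coin.
lean : Coin → ℕ → Status → Status
lean idle 1 s = blank
lean _    _ s = s

act : ℕ → Coin → ℕ → ℕ → Status
act t k zero    zero    = tie t k
act t k (suc r) (suc b) = act t k r b
act t k (suc r) zero    = lean k (suc r) blue
act t k zero    (suc b) = lean k (suc b) red

T D : ℕ
T = 40
D = 1000000000000

open Recursion coins act D using (Sufficient; sufficient; run-cut)

opaque
  unfolding Σˢ

  enough : Sufficient 8704 10000 T
  -- Evaluates all 40 rounds on numerals, in fixed-point arithmetic with twelve decimal places.
  enough = sufficient (≤ᵇ⇒≤ _ _ _)

rational-cut : ∀ {n} {G : Graph n} → ∃[ A ] 8704 * length (edges G) ≤ 10000 * length (cut G A) →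
               Σ[ A ∈ Subset n ] (+ length (cut G A) ℚ./ 1 ℚ.≥ (+ 8704 ℚ./ 10000) ℚ.* (+ length (edges G) ℚ./ 1))
rational-cut {G = G} (A , large) = A , rational-bound (length (cut G A)) (length (edges G)) large

corollary4 :
    ∃[ g ] g > 0 ×
      (∀ (n : ℕ) (G : Graph n) (γ : ℕ ⁺) →
        Cubic G → IsGirth G γ → [ g ] ≤⁺ γ →
        Σ[ A ∈ Subset n ]
          (+ length (cut G A) ℚ./ 1 ℚ.≥ (+ 8704 ℚ./ 10000) ℚ.* (+ length (edges G) ℚ./ 1)))
-- The girth is 82: the walks glued from two branches of depth 40 have at most 81 vertices and must
-- contain no cycle.
corollary4 = 2 + (T + T) , s≤s z≤n , λ n G γ cubic girth g≤γ →
  rational-cut {G = G} (run-cut idle T G cubic (girth-bound girth g≤γ) enough)
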